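{- Fix a nonnegative integer $k$, and for positive integers $m$ let $e_k(m)$ be the number of partial orders on $\{1,\dots,m+k\}$ whose set of minimal elements is exactly $\{1,\dots,m\}$. Put $z_2=2$, $z_3=6$, $z_4=20$ and $z_i=2i$ for $i\ge5$. Then, as $m\to\infty$, $$e_k(m)=2^{km}+\sum_{i=2}^{k} z_i\binom{k}{i}\bigl(2^{k-1}+2^{k-i}\bigr)^m+O\bigl(2^{(k-1)m}\bigr)=2^{km}\bigl(1+O((\tfrac34)^m)\bigr).$$ In particular $e_k(m)$ is asymptotically equal to $2^{km}$. -}

module Defs where

open import Data.Bool using (Bool; true; false; _∧_; _∨_; not; if_then_else_)
open import Data.Nat using (ℕ; zero; suc; _+_; _*_; _^_; _≡ᵇ_; _<ᵇ_)
open import Data.Nat.Combinatorics using (_C_)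
open import Data.Fin using (Fin; toℕ) renaming (zero to fzero; suc to fsuc)
open import Data.List using (List; []; _∷_; concatMap; map; length; filter)
open import Relation.Binary.PropositionalEquality using (_≡_)
open import Data.Bool.Properties using (T?)

-- All functions Fin n → A whose values are drawn from the list xs.
-- (With xs listing every element of A once, this lists every function once.)
allFuns : {A : Set} → (n : ℕ) → List A → List (Fin n → A)
allFuns zero    xs = (λ ()) ∷ []
allFuns (suc n) xs =
  concatMap (λ a → map (λ f → cons a f) (allFuns n xs)) xs
  where
  cons : _ → (Fin n → _) → Fin (suc n) → _
  cons a f fzero    = a
  cons a f (fsuc i) = f i

-- A (decidable) binary relation on Fin n, as a Boolean matrix: R x y = true means x ≤ y.
Rel : ℕ → Set
Rel n = Fin n → Fin n → Bool

allRels : (n : ℕ) → List (Rel n)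
allRels n = allFuns n (allFuns n (true ∷ false ∷ []))

_≟ᶠ_ : {n : ℕ} → Fin n → Fin n → Bool
i ≟ᶠ j = toℕ i ≡ᵇ toℕ j

_⇒ᵇ_ : Bool → Bool → Bool
a ⇒ᵇ b = not a ∨ b

∀ᶠ : (n : ℕ) → (Fin n → Bool) → Bool
∀ᶠ zero    p = true
∀ᶠ (suc n) p = p fzero ∧ ∀ᶠ n (λ i → p (fsuc i))

isPartialOrder : (n : ℕ) → Rel n → Bool
isPartialOrder n R =
  ∀ᶠ n (λ x → R x x) ∧
  ∀ᶠ n (λ x → ∀ᶠ n (λ y → (R x y ∧ R y x) ⇒ᵇ (x ≟ᶠ y))) ∧
  ∀ᶠ n (λ x → ∀ᶠ n (λ y → ∀ᶠ n (λ z → (R x y ∧ R y z) ⇒ᵇ R x z)))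

isMinimal : (n : ℕ) → Rel n → Fin n → Bool
isMinimal n R x = ∀ᶠ n (λ y → R y x ⇒ᵇ (y ≟ᶠ x))

-- Elements of Fin (m + k) are 0,…,m+k-1, standing for 1,…,m+k.
-- The set of minimal elements is exactly {0,…,m-1} (i.e. {1,…,m}).
minimalsExactlyFirst : (m n : ℕ) → Rel n → Bool
minimalsExactlyFirst m n R =
  ∀ᶠ n (λ x → if isMinimal n R x then toℕ x <ᵇ m else not (toℕ x <ᵇ m))

e : ℕ → ℕ → ℕ
e k m = length (filter (λ R → T? (isPartialOrder (m + k) R ∧ minimalsExactlyFirst m (m + k) R))
                       (allRels (m + k)))

-- z₂ = 2, z₃ = 6, z₄ = 20, zᵢ = 2i for i ≥ 5 (only used for i ≥ 2).
z : ℕ → ℕ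
z 2 = 2
z 3 = 6
z 4 = 20
z i = 2 * i

-- Σ_{i=a}^{b} f i  (empty if b < a); defined by recursion on the number of terms.
sumFromTo : ℕ → ℕ → (ℕ → ℕ) → ℕ
sumFromTo a b f = go a (suc b Data.Nat.∸ a)
  where
  go : ℕ → ℕ → ℕ
  go i zero    = 0
  go i (suc t) = f i + go (suc i) t

mainTerm : ℕ → ℕ → ℕ
mainTerm k m = 2 ^ (k * m) + sumFromTo 2 k (λ i → z i * (k C i) * (2 ^ (k Data.Nat.∸ 1) + 2 ^ (k Data.Nat.∸ i)) ^ m)

{-# OPTIONS --safe #-}
-- Removing the m minimal elements of an order leaves a poset Q on k elements
-- together with an m-tuple of up-sets of Q covering Q.  All but O(2^((k-1)m))
-- of the tuples cover, so with u(Q) the number of up-sets of Q,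
-- e k m = Σ_Q u(Q)^m + O(2^((k-1)m)), and only the Q with u(Q) > 2^(k-1) count.
-- A comparability x < y forbids one of the four patterns of an up-set on {x, y};
-- counting patterns shows u(Q) ≤ 2^(k-1) as soon as Q contains a 3-chain, an N,
-- a V or Λ disjoint from a further edge, or three disjoint edges.  Otherwise Q
-- is an antichain, a star on i ≥ 2 elements (pointing up or down) or two
-- disjoint chains x < y, plus isolated points.  The last two types have
-- u(Q) = 2^(k-1) + 2^(k-i), with i = 4 for the two chains, and there are
-- z i * (k C i) of them: 2i stars (2 if i = 2) and, if i = 4, 12 pairs of chains.

module Submission where

open import Defs
open import Data.Bool using (Bool; true; false; _∧_; _∨_; not; if_then_else_; T)
open import Data.Bool.Properties using (T?; T-∧; T-∨; T-≡; ∨-comm)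
open import Data.Empty using (⊥; ⊥-elim)
open import Data.Fin using (Fin; toℕ; _↑ˡ_; _↑ʳ_; splitAt; join) renaming (zero to fzero; suc to fsuc)
open import Data.Fin.Patterns using (0F; 1F; 2F; 3F; 4F; 5F)
import Data.Fin.Properties as F
open import Data.List using (List; []; _∷_; map; concatMap; filter; length; _++_; allFin; cartesianProduct; tabulate)
open import Data.List.Properties using (map-++; length-++; length-map; length-tabulate)
open import Data.List.Membership.DecPropositional using (_∈?_)
open import Data.List.Membership.Propositional using (_∈_; lose; find)
open import Data.List.Membership.Propositional.Properties
open import Data.List.Relation.Unary.All as All using (All; []; _∷_)
import Data.List.Relation.Unary.All.Properties as AllP
open import Data.List.Relation.Unary.AllPairs as AP using (AllPairs; []; _∷_)
import Data.List.Relation.Unary.AllPairs.Properties as APP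
open import Data.List.Relation.Unary.Any using (here; there; _─_)
import Data.List.Relation.Unary.Unique.Propositional.Properties as UP
open import Data.Nat
open import Data.Nat.Combinatorics using (nCk+nC[k+1]≡[n+1]C[k+1]; k>n⇒nCk≡0) renaming (_C_ to _choose_)
open import Data.Nat.ListAction using (sum)
open import Data.Nat.ListAction.Properties using (sum-++)
open import Data.Nat.Properties
open import Data.Nat.Tactic.RingSolver using (solve-∀)
open import Data.Product using (_×_; _,_; ∃-syntax; proj₁; proj₂; uncurry)
open import Data.Product.Properties using (,-injective)
open import Data.Sum using (_⊎_; inj₁; inj₂; [_,_]′)
open import Data.Unit using (⊤; tt)
open import Data.Vec using (Vec; []; _∷_; lookup)
open import Data.Vec.Functional using (updateAt) renaming (_∷_ to _◂_)
open import Data.Vec.Functional.Properties using (updateAt-updates; updateAt-minimal)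
open import Data.Vec.Relation.Unary.All using ([]; _∷_)
open import Data.Vec.Relation.Unary.All.Properties using (lookup⁺)
open import Data.Vec.Relation.Unary.AllPairs as VAP using ([]; _∷_)
open import Data.Vec.Relation.Unary.Unique.Propositional using (Unique)
open import Data.Vec.Relation.Unary.Unique.Propositional.Properties as VUP using (lookup-injective)
open import Function using (_∘_; id; case_of_; const; flip)
open import Function.Bundles using (Equivalence)
open import Relation.Binary.Definitions using (tri<; tri≈; tri>)
open import Relation.Binary.PropositionalEquality using (_≡_; _≢_; refl; sym; trans; cong; cong₂; subst; subst₂; ≢-sym; module ≡-Reasoning)
open import Relation.Nullary using (¬_; Dec; yes; no; contradiction; ¬?; _×-dec_)
open import Relation.Nullary.Decidable using (decidable-stable; toWitness; fromWitness; ⌊_⌋)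

-- The pattern bounds are statements about densities. If a subset is overwritten at r chosen points
-- by a pattern, and both are uniformly random, the result is again uniformly random; so the
-- proportion of up-sets among all subsets is at most the proportion of admissible patterns among
-- the 2^r possible ones. One half is the threshold because the error term has this size anyway: a
-- tuple that does not cover Q avoids some element in all its members, and half of all subsets avoid
-- a given element. Relations and subsets are functions into `Bool`, so the enumerations are free of
-- repetitions only up to pointwise equality. Objects of different kinds are therefore compared by
-- two inequalities, each given by an injection that is a mere relation between list entries. The
-- exceptional posets get syntactic codes, grouped by their set of non-isolated points, so that the
-- number of posets of each type becomes the length of a list.

private variable
  A B : Set
  k m n r : ℕ

-- Boolean tests and their propositional meaning

∀ᶠ-elim : ∀ n {p : Fin n → Bool} → T (∀ᶠ n p) → ∀ i → T (p i)
∀ᶠ-elim (suc n) h fzero    = proj₁ (Equivalence.to T-∧ h)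
∀ᶠ-elim (suc n) h (fsuc i) = ∀ᶠ-elim n (proj₂ (Equivalence.to T-∧ h)) i

∀ᶠ-intro : ∀ n {p : Fin n → Bool} → (∀ i → T (p i)) → T (∀ᶠ n p)
∀ᶠ-intro zero    h = tt
∀ᶠ-intro (suc n) h = Equivalence.from T-∧ (h fzero , ∀ᶠ-intro n (h ∘ fsuc))

⇒ᵇ-elim : ∀ {a b} → T (a ⇒ᵇ b) → T a → T b
⇒ᵇ-elim {true} h _ = h

⇒ᵇ-intro : ∀ {a b} → (T a → T b) → T (a ⇒ᵇ b)
⇒ᵇ-intro {false} h = tt
⇒ᵇ-intro {true}  h = h tt

≟ᶠ-elim : {i j : Fin n} → T (i ≟ᶠ j) → i ≡ j
≟ᶠ-elim {i = i} {j} h = F.toℕ-injective (≡ᵇ⇒≡ (toℕ i) (toℕ j) h)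

≟ᶠ-intro : {i j : Fin n} → i ≡ j → T (i ≟ᶠ j)
≟ᶠ-intro {i = i} refl = ≡⇒≡ᵇ (toℕ i) (toℕ i) refl

T-ext : ∀ {a b} → (T a → T b) → (T b → T a) → a ≡ b
T-ext {false} {false} f g = refl
T-ext {false} {true}  f g = ⊥-elim (g tt)
T-ext {true}  {false} f g = ⊥-elim (f tt)
T-ext {true}  {true}  f g = refl

infix 4 _≈_
_≈_ : {I J : Set} → (I → J → Bool) → (I → J → Bool) → Set
R ≈ R′ = ∀ x y → R x y ≡ R′ x y

≈-sym : {I J : Set} {R R′ : I → J → Bool} → R ≈ R′ → R′ ≈ R
≈-sym h x y = sym (h x y)

≈-trans : {I J : Set} {R R′ R″ : I → J → Bool} → R ≈ R′ → R′ ≈ R″ → R ≈ R″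
≈-trans h h′ x y = trans (h x y) (h′ x y)

-- Weighted sums over lists and their comparison by injections

sumOver : List A → (A → ℕ) → ℕ
sumOver xs w = sum (map w xs)

sumOver-─ : ∀ (w : A → ℕ) {y ys} (p : y ∈ ys) → sumOver ys w ≡ w y + sumOver (ys ─ p) w
sumOver-─ w (here refl)            = refl
sumOver-─ w {y} {x ∷ ys} (there p) = begin
  w x + sumOver ys w                ≡⟨ cong (w x +_) (sumOver-─ w p) ⟩
  w x + (w y + sumOver (ys ─ p) w)  ≡⟨ sym (+-assoc (w x) _ _) ⟩
  w x + w y + sumOver (ys ─ p) w    ≡⟨ cong (_+ sumOver (ys ─ p) w) (+-comm (w x) (w y)) ⟩
  w y + w x + sumOver (ys ─ p) w    ≡⟨ +-assoc (w y) _ _ ⟩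
  w y + (w x + sumOver (ys ─ p) w)  ∎
  where open ≡-Reasoning

∈-─ : ∀ {y z : A} {ys} (p : y ∈ ys) → z ∈ ys → z ≡ y ⊎ z ∈ (ys ─ p)
∈-─ (here refl) (here refl) = inj₁ refl
∈-─ (here refl) (there q)   = inj₂ q
∈-─ (there p)   (here refl) = inj₂ (here refl)
∈-─ (there p)   (there q) with ∈-─ p q
... | inj₁ e = inj₁ e
... | inj₂ r = inj₂ (there r)

-- The injection is a relation M, so that neither side needs decidable or
-- propositional equality.
sumOver-injection : {_~_ : A → A → Set} (M : A → B → Set) (w : A → ℕ) (v : B → ℕ) →
  ∀ xs ys → AllPairs (λ a b → ¬ a ~ b) xs →
  (∀ {x} → x ∈ xs → ∃[ y ] y ∈ ys × M x y × w x ≤ v y) →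
  (∀ {x x′ y} → M x y → M x′ y → x ~ x′) →
  sumOver xs w ≤ sumOver ys v
sumOver-injection M w v []       ys _          f inj = z≤n
sumOver-injection M w v (x ∷ xs) ys (x# ∷ xs#) f inj with f (here refl)
... | y , y∈ , Mxy , le = begin
  w x + sumOver xs w        ≤⟨ +-mono-≤ le (sumOver-injection M w v xs (ys ─ y∈) xs# f′ inj) ⟩
  v y + sumOver (ys ─ y∈) v ≡⟨ sumOver-─ v y∈ ⟨
  sumOver ys v              ∎
  where
  open ≤-Reasoning
  f′ : ∀ {x′} → x′ ∈ xs → ∃[ y′ ] y′ ∈ (ys ─ y∈) × M x′ y′ × w x′ ≤ v y′
  f′ x′∈ with f (there x′∈)
  ... | y′ , y′∈ , Mx′y′ , le′ with ∈-─ y∈ y′∈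
  ... | inj₁ refl = contradiction (inj Mxy Mx′y′) (All.lookup x# x′∈)
  ... | inj₂ y′∈′ = y′ , y′∈′ , Mx′y′ , le′

sumOver-++ : ∀ (w : A → ℕ) xs ys → sumOver (xs ++ ys) w ≡ sumOver xs w + sumOver ys w
sumOver-++ w xs ys = trans (cong sum (map-++ w xs ys)) (sum-++ (map w xs) (map w ys))

sumOver-concatMap : ∀ (w : B → ℕ) (f : A → List B) xs →
  sumOver (concatMap f xs) w ≡ sumOver xs (λ x → sumOver (f x) w)
sumOver-concatMap w f []       = refl
sumOver-concatMap w f (x ∷ xs) = trans (sumOver-++ w (f x) (concatMap f xs))
                                   (cong (sumOver (f x) w +_) (sumOver-concatMap w f xs))

sumOver-map : ∀ (w : B → ℕ) (f : A → B) xs → sumOver (map f xs) w ≡ sumOver xs (w ∘ f)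
sumOver-map w f []       = refl
sumOver-map w f (x ∷ xs) = cong (w (f x) +_) (sumOver-map w f xs)

sumOver-mono : ∀ {w v : A → ℕ} xs → (∀ {x} → x ∈ xs → w x ≤ v x) → sumOver xs w ≤ sumOver xs v
sumOver-mono []       h = z≤n
sumOver-mono (x ∷ xs) h = +-mono-≤ (h (here refl)) (sumOver-mono xs (h ∘ there))

sumOver-cong : ∀ {w v : A → ℕ} xs → (∀ {x} → x ∈ xs → w x ≡ v x) → sumOver xs w ≡ sumOver xs v
sumOver-cong []       h = refl
sumOver-cong (x ∷ xs) h = cong₂ _+_ (h (here refl)) (sumOver-cong xs (h ∘ there))

sumOver-const : ∀ c (xs : List A) → sumOver xs (const c) ≡ length xs * c
sumOver-const c []       = refl
sumOver-const c (x ∷ xs) = cong (c +_) (sumOver-const c xs)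

sumOver-1 : (xs : List A) → sumOver xs (const 1) ≡ length xs
sumOver-1 xs = trans (sumOver-const 1 xs) (*-identityʳ (length xs))

concatMap-AllPairs : {R : B → B → Set} {S : A → A → Set} (f : A → List B) → ∀ xs →
  (∀ {x} → x ∈ xs → AllPairs R (f x)) → AllPairs S xs →
  (∀ {x x′} → S x x′ → ∀ {y y′} → y ∈ f x → y′ ∈ f x′ → R y y′) →
  AllPairs R (concatMap f xs)
concatMap-AllPairs f xs hf hS hR =
  APP.concat⁺ (AllP.map⁺ (All.tabulate hf))
              (APP.map⁺ (AP.map (λ s → All.tabulate λ y∈ → All.tabulate λ y′∈ → hR s y∈ y′∈) hS))

∈-concatMap-intro : ∀ {f : A → List B} {xs x y} → x ∈ xs → y ∈ f x → y ∈ concatMap f xs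
∈-concatMap-intro {f = f} x∈ y∈ = ∈-concatMap⁺ f (lose x∈ y∈)

∈-concatMap-elim : ∀ {f : A → List B} xs {y} → y ∈ concatMap f xs → ∃[ x ] x ∈ xs × y ∈ f x
∈-concatMap-elim {f = f} xs y∈ = find (∈-concatMap⁻ f {xs = xs} y∈)

-- Enumeration of functions, subsets and relations up to pointwise equality

allFuns-complete : ∀ n (R : Fin n → A → Set) xs → (∀ i → ∃[ x ] x ∈ xs × R i x) →
  ∃[ f ] f ∈ allFuns n xs × (∀ i → R i (f i))
allFuns-complete zero    R xs h = _ , here refl , λ ()
allFuns-complete (suc n) R xs h with h fzero | allFuns-complete n (R ∘ fsuc) xs (h ∘ fsuc)
... | x , x∈ , Rx | f , f∈ , Rf =
  _ , ∈-concatMap-intro x∈ (∈-map⁺ _ f∈) , λ { fzero → Rx ; (fsuc i) → Rf i }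

allFuns-sound : ∀ n {xs : List A} {f} → f ∈ allFuns n xs → ∀ i → f i ∈ xs
allFuns-sound (suc n) {xs} f∈ i with ∈-concatMap-elim xs f∈
... | a , a∈ , f∈′ with ∈-map⁻ _ f∈′
allFuns-sound (suc n) {xs} f∈ fzero    | a , a∈ , _ | g , g∈ , refl = a∈
allFuns-sound (suc n) {xs} f∈ (fsuc i) | a , a∈ , _ | g , g∈ , refl = allFuns-sound n g∈ i

allFuns-unique : {_~_ : A → A → Set} → ∀ n xs → AllPairs (λ a b → ¬ a ~ b) xs →
  AllPairs (λ f g → ¬ (∀ i → f i ~ g i)) (allFuns n xs)
allFuns-unique zero    xs h = [] ∷ []
allFuns-unique {_~_ = _~_} (suc n) xs h = concatMap-AllPairs _ xs
  (λ _ → APP.map⁺ (AP.map (λ f# f~g → f# (f~g ∘ fsuc)) (allFuns-unique n xs h)))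
  h λ x# y∈ y′∈ y~y′ → case (∈-map⁻ _ y∈ , ∈-map⁻ _ y′∈) of
    λ { ((_ , _ , refl) , (_ , _ , refl)) → x# (y~y′ fzero) }

length-allFuns : ∀ n (xs : List A) → length (allFuns n xs) ≡ length xs ^ n
length-allFuns zero    xs = refl
length-allFuns (suc n) xs = begin
  length (allFuns (suc n) xs)                         ≡⟨ sumOver-1 (allFuns (suc n) xs) ⟨
  sumOver (allFuns (suc n) xs) (const 1)              ≡⟨ sumOver-concatMap (const 1) _ xs ⟩
  sumOver xs _                                        ≡⟨ sumOver-cong xs (λ _ → trans (sumOver-1 (map _ (allFuns n xs))) (trans (length-map _ (allFuns n xs)) (length-allFuns n xs))) ⟩
  sumOver xs (const (length xs ^ n))                  ≡⟨ sumOver-const _ xs ⟩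
  length xs * length xs ^ n                           ∎
  where open ≡-Reasoning

bools : List Bool
bools = true ∷ false ∷ []

∈-bools : ∀ b → b ∈ bools
∈-bools true  = here refl
∈-bools false = there (here refl)

bools-unique : AllPairs (λ a b → ¬ a ≡ b) bools
bools-unique = ((λ ()) ∷ []) ∷ [] ∷ []

subsets : ∀ k → List (Fin k → Bool)
subsets k = allFuns k bools

subsets-complete : ∀ {k} (f : Fin k → Bool) → ∃[ g ] g ∈ subsets k × (∀ i → f i ≡ g i)
subsets-complete {k} f = allFuns-complete k (λ i b → f i ≡ b) bools λ i → f i , ∈-bools (f i) , refl

subsets-unique : ∀ k → AllPairs (λ f g → ¬ (∀ i → f i ≡ g i)) (subsets k)
subsets-unique k = allFuns-unique k bools bools-unique

-- A row is listed only up to pointwise equality. This second use is why `allFuns-complete` chooses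
-- values related by an arbitrary `R` instead of looking up a given function.
allRels-complete : ∀ {k} (R : Rel k) → ∃[ R′ ] R′ ∈ allRels k × R ≈ R′
allRels-complete {k} R = allFuns-complete k (λ x r → ∀ y → R x y ≡ r y) (subsets k) (λ x → subsets-complete (R x))

allRels-unique : ∀ k → AllPairs (λ R R′ → ¬ R ≈ R′) (allRels k)
allRels-unique k = allFuns-unique k (subsets k) (subsets-unique k)

-- Orders as tuples of up-sets

record IsPoset {n} (R : Rel n) : Set where
  field
    reflexive : ∀ x → T (R x x)
    antisym   : ∀ {x y} → T (R x y) → T (R y x) → x ≡ y
    transitive : ∀ {x y z} → T (R x y) → T (R y z) → T (R x z)

open IsPoset

isPartialOrder-elim : {R : Rel n} → T (isPartialOrder n R) → IsPoset R
isPartialOrder-elim {n} {R} h with Equivalence.to T-∧ h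
... | r , h′ with Equivalence.to T-∧ h′
... | a , t = record
  { reflexive  = ∀ᶠ-elim n r
  ; antisym    = λ {x} {y} p q → ≟ᶠ-elim (⇒ᵇ-elim (∀ᶠ-elim n (∀ᶠ-elim n a x) y) (Equivalence.from T-∧ (p , q)))
  ; transitive = λ {x} {y} {z} p q →
      ⇒ᵇ-elim (∀ᶠ-elim n (∀ᶠ-elim n (∀ᶠ-elim n t x) y) z) (Equivalence.from T-∧ (p , q))
  }

isPartialOrder-intro : {R : Rel n} → IsPoset R → T (isPartialOrder n R)
isPartialOrder-intro {n} {R} P = Equivalence.from T-∧
  ( ∀ᶠ-intro n (reflexive P)
  , Equivalence.from (T-∧ {∀ᶠ n λ x → ∀ᶠ n λ y → (R x y ∧ R y x) ⇒ᵇ (x ≟ᶠ y)})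
    ( (∀ᶠ-intro n λ x → ∀ᶠ-intro n λ y → ⇒ᵇ-intro λ h →
         ≟ᶠ-intro (uncurry (antisym P) (Equivalence.to T-∧ h)))
    , (∀ᶠ-intro n λ x → ∀ᶠ-intro n λ y → ∀ᶠ-intro n λ z → ⇒ᵇ-intro λ h →
         uncurry (transitive P) (Equivalence.to T-∧ h)) ) )

IsPoset-resp-≈ : {R R′ : Rel n} → R ≈ R′ → IsPoset R → IsPoset R′
IsPoset-resp-≈ {R = R} {R′} eq P = record
  { reflexive  = λ x → to (reflexive P x)
  ; antisym    = λ p q → antisym P (from p) (from q)
  ; transitive = λ p q → to (transitive P (from p) (from q))
  }
  where
  to : ∀ {x y} → T (R x y) → T (R′ x y)
  to {x} {y} = subst T (eq x y)
  from : ∀ {x y} → T (R′ x y) → T (R x y)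
  from {x} {y} = subst T (sym (eq x y))

Minimal : Rel n → Fin n → Set
Minimal R x = ∀ y → T (R y x) → y ≡ x

record MinimalsFirst (m : ℕ) {n} (R : Rel n) : Set where
  field
    minimal⇒first : ∀ x → Minimal R x → toℕ x < m
    first⇒minimal : ∀ x → toℕ x < m → Minimal R x

open MinimalsFirst

isMinimal-elim : {R : Rel n} {x : Fin n} → T (isMinimal n R x) → Minimal R x
isMinimal-elim {n} h y r = ≟ᶠ-elim (⇒ᵇ-elim (∀ᶠ-elim n h y) r)

isMinimal-intro : {R : Rel n} {x : Fin n} → Minimal R x → T (isMinimal n R x)
isMinimal-intro {n} h = ∀ᶠ-intro n λ y → ⇒ᵇ-intro (≟ᶠ-intro ∘ h y)

if-iff-elim : ∀ a {b} → T (if a then b else not b) → (T a → T b) × (T b → T a)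
if-iff-elim true      h = const h , const tt
if-iff-elim false {b} h = (λ ()) , λ tb → not-both b h tb
  where
  not-both : ∀ b → T (not b) → T b → ⊥
  not-both false _ ()

if-iff-intro : ∀ a {b} → (T a → T b) → (T b → T a) → T (if a then b else not b)
if-iff-intro true          f g = f tt
if-iff-intro false {false} f g = tt
if-iff-intro false {true}  f g = g tt

minimalsExactlyFirst-elim : {R : Rel n} → T (minimalsExactlyFirst m n R) → MinimalsFirst m R
minimalsExactlyFirst-elim {n} {m} {R} h = record
  { minimal⇒first = λ x min → <ᵇ⇒< (toℕ x) m (proj₁ (iff x) (isMinimal-intro {R = R} min))
  ; first⇒minimal = λ x lt → isMinimal-elim {R = R} (proj₂ (iff x) (<⇒<ᵇ lt))
  }
  where iff = λ x → if-iff-elim (isMinimal n R x) (∀ᶠ-elim n h x)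

minimalsExactlyFirst-intro : {R : Rel n} → MinimalsFirst m R → T (minimalsExactlyFirst m n R)
minimalsExactlyFirst-intro {n} {m} {R} M = ∀ᶠ-intro n λ x → if-iff-intro (isMinimal n R x)
  (λ h → <⇒<ᵇ (minimal⇒first M x (isMinimal-elim {R = R} h)))
  (λ h → isMinimal-intro {R = R} (first⇒minimal M x (<ᵇ⇒< (toℕ x) m h)))

MinimalsFirst-resp-≈ : {R R′ : Rel n} → R ≈ R′ → MinimalsFirst m R → MinimalsFirst m R′
MinimalsFirst-resp-≈ eq M = record
  { minimal⇒first = λ x min → minimal⇒first M x λ y → min y ∘ subst T (eq y x)
  ; first⇒minimal = λ x lt y → first⇒minimal M x lt y ∘ subst T (sym (eq y x))
  }

isUpset : Rel k → (Fin k → Bool) → Bool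
isUpset {k} Q f = ∀ᶠ k λ x → ∀ᶠ k λ y → (Q x y ∧ f x) ⇒ᵇ f y

Upset : Rel k → (Fin k → Bool) → Set
Upset Q f = ∀ {x y} → T (Q x y) → T (f x) → T (f y)

isUpset-elim : {Q : Rel k} {f : Fin k → Bool} → T (isUpset Q f) → Upset Q f
isUpset-elim {k} h {x} {y} q fx = ⇒ᵇ-elim (∀ᶠ-elim k (∀ᶠ-elim k h x) y) (Equivalence.from T-∧ (q , fx))

isUpset-intro : {Q : Rel k} {f : Fin k → Bool} → Upset Q f → T (isUpset Q f)
isUpset-intro {k} h = ∀ᶠ-intro k λ x → ∀ᶠ-intro k λ y → ⇒ᵇ-intro λ qf → uncurry h (Equivalence.to T-∧ qf)

Upset-resp : {Q Q′ : Rel k} {f f′ : Fin k → Bool} → Q ≈ Q′ → (∀ i → f i ≡ f′ i) → Upset Q f → Upset Q′ f′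
Upset-resp eq eqf U {x} {y} q fx = subst T (eqf y) (U (subst T (sym (eq x y)) q) (subst T (sym (eqf x)) fx))

posets : ∀ k → List (Rel k)
posets k = filter (λ Q → T? (isPartialOrder k Q)) (allRels k)

upsets : Rel k → List (Fin k → Bool)
upsets {k} Q = filter (λ f → T? (isUpset Q f)) (subsets k)

upsetCount : Rel k → ℕ
upsetCount Q = length (upsets Q)

posets-unique : ∀ k → AllPairs (λ R R′ → ¬ R ≈ R′) (posets k)
posets-unique k = APP.filter⁺ _ (allRels-unique k)

posets-complete : {Q : Rel k} → IsPoset Q → ∃[ Q′ ] Q′ ∈ posets k × Q ≈ Q′
posets-complete {Q = Q} P with allRels-complete Q
... | Q′ , Q′∈ , eq = Q′ , ∈-filter⁺ _ Q′∈ (isPartialOrder-intro (IsPoset-resp-≈ eq P)) , eq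

posets-sound : {Q : Rel k} → Q ∈ posets k → IsPoset Q
posets-sound {k} Q∈ = isPartialOrder-elim (proj₂ (∈-filter⁻ (λ Q → T? (isPartialOrder k Q)) {xs = allRels k} Q∈))

upsets-complete : {Q : Rel k} {f : Fin k → Bool} → Upset Q f → ∃[ g ] g ∈ upsets Q × (∀ i → f i ≡ g i)
upsets-complete {Q = Q} {f} U with subsets-complete f
... | g , g∈ , eq = g , ∈-filter⁺ _ g∈ (isUpset-intro {Q = Q} (Upset-resp {Q = Q} (λ _ _ → refl) eq U)) , eq

upsets-sound : {Q : Rel k} {f : Fin k → Bool} → f ∈ upsets Q → Upset Q f
upsets-sound {k} {Q} {f} f∈ = isUpset-elim {Q = Q} (proj₂ (∈-filter⁻ (λ f → T? (isUpset Q f)) {xs = subsets k} f∈))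

-- The `inj₁` elements are to become the minimal ones: they are pairwise incomparable and have
-- nothing of `Q` below them, and `B i` is the set of elements of `Q` above `i`.
glue⊎ : Rel k → (Fin m → Fin k → Bool) → Fin m ⊎ Fin k → Fin m ⊎ Fin k → Bool
glue⊎ Q B (inj₁ i) (inj₁ j) = i ≟ᶠ j
glue⊎ Q B (inj₁ i) (inj₂ b) = B i b
glue⊎ Q B (inj₂ a) (inj₁ j) = false
glue⊎ Q B (inj₂ a) (inj₂ b) = Q a b

glue : Rel k → (Fin m → Fin k → Bool) → Rel (m + k)
glue {k} {m} Q B x y = glue⊎ Q B (splitAt m x) (splitAt m y)

upper : Rel (m + k) → Rel k
upper {m} R a b = R (m ↑ʳ a) (m ↑ʳ b)

cross : Rel (m + k) → Fin m → Fin k → Bool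
cross {m} {k} R i b = R (i ↑ˡ k) (m ↑ʳ b)

upper-glue : (Q : Rel k) (B : Fin m → Fin k → Bool) → upper {m} (glue Q B) ≈ Q
upper-glue {k} {m} Q B a b rewrite F.splitAt-↑ʳ m k a | F.splitAt-↑ʳ m k b = refl

cross-glue : (Q : Rel k) (B : Fin m → Fin k → Bool) → cross {m} (glue Q B) ≈ B
cross-glue {k} {m} Q B i b rewrite F.splitAt-↑ˡ m i k | F.splitAt-↑ʳ m k b = refl

splitAt-injective : ∀ m {x y : Fin (m + k)} → splitAt m x ≡ splitAt m y → x ≡ y
splitAt-injective {k} m {x} {y} eq =
  trans (sym (F.join-splitAt m k x)) (trans (cong (join m k) eq) (F.join-splitAt m k y))

data Split (m k : ℕ) : Fin (m + k) → Set where
  low  : (i : Fin m) → Split m k (i ↑ˡ k)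
  high : (a : Fin k) → Split m k (m ↑ʳ a)

split : ∀ m (x : Fin (m + k)) → Split m k x
split {k} m x with splitAt m x in eq
... | inj₁ i = subst (Split m k) (F.splitAt⁻¹-↑ˡ eq) (low i)
... | inj₂ a = subst (Split m k) (F.splitAt⁻¹-↑ʳ eq) (high a)

low-< : ∀ {m} k (i : Fin m) → toℕ (i ↑ˡ k) < m
low-< k i = subst (_< _) (sym (F.toℕ-↑ˡ i k)) (F.toℕ<n i)

high-≮ : ∀ m (a : Fin k) → ¬ toℕ (m ↑ʳ a) < m
high-≮ m a lt = <⇒≱ lt (subst (m ≤_) (sym (F.toℕ-↑ʳ m a)) (m≤m+n m (toℕ a)))

low≢high : ∀ {i : Fin m} {a : Fin k} → ¬ i ↑ˡ k ≡ m ↑ʳ a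
low≢high {m} {k} {i} {a} eq = high-≮ m a (subst (λ x → toℕ x < m) eq (low-< k i))

module _ {Q : Rel k} {B : Fin m → Fin k → Bool} (P : IsPoset Q) (up : ∀ i → Upset Q (B i)) where

  glue-poset : IsPoset (glue Q B)
  glue-poset = record
    { reflexive  = λ x → rfl (splitAt m x)
    ; antisym    = λ {x} {y} p q → splitAt-injective m (asym (splitAt m x) (splitAt m y) p q)
    ; transitive = λ {x} {y} {z} p q → tr (splitAt m x) (splitAt m y) (splitAt m z) p q
    }
    where
    rfl : ∀ s → T (glue⊎ Q B s s)
    rfl (inj₁ i) = ≟ᶠ-intro {i = i} refl
    rfl (inj₂ a) = reflexive P a
    asym : ∀ s t → T (glue⊎ Q B s t) → T (glue⊎ Q B t s) → s ≡ t
    asym (inj₁ i) (inj₁ j) p q = cong inj₁ (≟ᶠ-elim p)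
    asym (inj₂ a) (inj₂ b) p q = cong inj₂ (antisym P p q)
    tr : ∀ s t u → T (glue⊎ Q B s t) → T (glue⊎ Q B t u) → T (glue⊎ Q B s u)
    tr (inj₁ i) (inj₁ j) u        p q rewrite ≟ᶠ-elim {i = i} {j} p = q
    tr (inj₁ i) (inj₂ b) (inj₂ c) p q = up i q p
    tr (inj₂ a) (inj₂ b) (inj₂ c) p q = transitive P p q

  -- Covering is what gives each element of `Q` something strictly below it, so that no further
  -- minimal elements appear.
  glue-minimals : (∀ a → ∃[ i ] T (B i a)) → MinimalsFirst m (glue Q B)
  glue-minimals cover = record
    { minimal⇒first = λ x → first x (split m x)
    ; first⇒minimal = λ x lt y → min x (split m x) lt y (split m y)
    }
    where
    first : ∀ x → Split m k x → Minimal (glue Q B) x → toℕ x < m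
    first _ (low i)  _ = low-< k i
    first _ (high a) h with cover a
    ... | i , Bia = ⊥-elim (low≢high (h (i ↑ˡ k) (subst T (sym (cross-glue Q B i a)) Bia)))
    min : ∀ x → Split m k x → toℕ x < m → ∀ y → Split m k y → T (glue Q B y x) → y ≡ x
    min _ (high a) lt y _ r = ⊥-elim (high-≮ m a lt)
    min _ (low i) lt _ (low j) r
      rewrite F.splitAt-↑ˡ m i k | F.splitAt-↑ˡ m j k = cong (_↑ˡ k) (≟ᶠ-elim r)
    min _ (low i) lt _ (high b) r
      rewrite F.splitAt-↑ˡ m i k | F.splitAt-↑ʳ m k b = ⊥-elim r

module _ {R : Rel (m + k)} (P : IsPoset R) (M : MinimalsFirst m R) where

  -- Minimality of the low elements forces the two blocks that `upper` and `cross` do not record: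
  -- equality among low elements, and no high element below a low one.
  glue-upper-cross : R ≈ glue (upper {m} R) (cross {m} R)
  glue-upper-cross x y = go x y (split m x) (split m y)
    where
    go : ∀ x y → Split m k x → Split m k y → R x y ≡ glue (upper {m} R) (cross {m} R) x y
    go _ _ (low i) (low j) rewrite F.splitAt-↑ˡ m i k | F.splitAt-↑ˡ m j k = T-ext
      (λ r → ≟ᶠ-intro (F.↑ˡ-injective k i j (first⇒minimal M _ (low-< k j) _ r)))
      (λ h → subst (λ l → T (R (i ↑ˡ k) (l ↑ˡ k))) (≟ᶠ-elim {i = i} {j} h) (reflexive P _))
    go _ _ (low i) (high b) rewrite F.splitAt-↑ˡ m i k | F.splitAt-↑ʳ m k b = refl
    go _ _ (high a) (low j) rewrite F.splitAt-↑ˡ m j k | F.splitAt-↑ʳ m k a = T-ext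
      (λ r → low≢high (sym (first⇒minimal M _ (low-< k j) _ r))) (λ ())
    go _ _ (high a) (high b) rewrite F.splitAt-↑ʳ m k a | F.splitAt-↑ʳ m k b = refl

  upper-poset : IsPoset (upper {m} R)
  upper-poset = record
    { reflexive  = λ x → reflexive P _
    ; antisym    = λ p q → F.↑ʳ-injective m _ _ (antisym P p q)
    ; transitive = transitive P
    }

  cross-upset : ∀ i → Upset (upper {m} R) (cross {m} R i)
  cross-upset i q c = transitive P c q

-- Counting pairs of a poset and a tuple of up-sets

Pairs : ℕ → ℕ → Set
Pairs k m = Rel k × (Fin m → Fin k → Bool)

_≈ₚ_ : Pairs k m → Pairs k m → Set
(Q , B) ≈ₚ (Q′ , B′) = Q ≈ Q′ × B ≈ B′

pairs : ∀ k m → List (Pairs k m)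
pairs k m = concatMap (λ Q → map (Q ,_) (allFuns m (upsets Q))) (posets k)

orders : ∀ k m → List (Rel (m + k))
orders k m = filter (λ R → T? (isPartialOrder (m + k) R ∧ minimalsExactlyFirst m (m + k) R)) (allRels (m + k))

orders-complete : {R : Rel (m + k)} → IsPoset R → MinimalsFirst m R → ∃[ R′ ] R′ ∈ orders k m × R ≈ R′
orders-complete {R = R} P M with allRels-complete R
... | R′ , R′∈ , eq = R′ ,
  ∈-filter⁺ _ R′∈ (Equivalence.from T-∧
    (isPartialOrder-intro (IsPoset-resp-≈ eq P) , minimalsExactlyFirst-intro (MinimalsFirst-resp-≈ eq M))) ,
  eq

orders-sound : {R : Rel (m + k)} → R ∈ orders k m → IsPoset R × MinimalsFirst m R
orders-sound {m} {k} R∈ with Equivalence.to T-∧ (proj₂ (∈-filter⁻ (λ R → T? (isPartialOrder (m + k) R ∧ minimalsExactlyFirst m (m + k) R)) {xs = allRels (m + k)} R∈))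
... | p , q = isPartialOrder-elim p , minimalsExactlyFirst-elim q

pairs-complete : {Q : Rel k} {B : Fin m → Fin k → Bool} → IsPoset Q → (∀ i → Upset Q (B i)) →
  ∃[ p ] p ∈ pairs k m × (Q , B) ≈ₚ p
pairs-complete {k} {m} {Q} {B} P up with posets-complete P
... | Q′ , Q′∈ , eq with allFuns-complete m (λ i f → ∀ a → B i a ≡ f a) (upsets Q′)
                         (λ i → upsets-complete (Upset-resp eq (λ _ → refl) (up i)))
... | B′ , B′∈ , eqB = (Q′ , B′) , ∈-concatMap-intro Q′∈ (∈-map⁺ (Q′ ,_) B′∈) , eq , eqB

pairs-sound : {p : Pairs k m} → p ∈ pairs k m → IsPoset (proj₁ p) × (∀ i → Upset (proj₁ p) (proj₂ p i))
pairs-sound {k} {m} p∈ with ∈-concatMap-elim (posets k) p∈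
... | Q , Q∈ , p∈′ with ∈-map⁻ (Q ,_) p∈′
... | B , B∈ , refl = posets-sound Q∈ , λ i → upsets-sound (allFuns-sound m B∈ i)

pairs-unique : ∀ k m → AllPairs (λ p q → ¬ p ≈ₚ q) (pairs k m)
pairs-unique k m = concatMap-AllPairs _ (posets k)
  (λ {Q} _ → APP.map⁺ (AP.map (λ # eq → # (proj₂ eq))
      (allFuns-unique m (upsets Q) (APP.filter⁺ _ (subsets-unique k)))))
  (posets-unique k)
  (λ Q# p∈ q∈ p≈q → case (∈-map⁻ _ p∈ , ∈-map⁻ _ q∈) of
    λ { ((_ , _ , refl) , (_ , _ , refl)) → Q# (proj₁ p≈q) })

length-pairs : ∀ k m → length (pairs k m) ≡ sumOver (posets k) (λ Q → upsetCount Q ^ m)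
length-pairs k m = begin
  length (pairs k m)            ≡⟨ sumOver-1 (pairs k m) ⟨
  sumOver (pairs k m) (const 1) ≡⟨ sumOver-concatMap (const 1) _ (posets k) ⟩
  sumOver (posets k) _          ≡⟨ sumOver-cong (posets k) (λ {Q} _ → trans (sumOver-1 (map (Q ,_) (allFuns m (upsets Q))))
                                     (trans (length-map _ (allFuns m (upsets Q))) (length-allFuns m (upsets Q)))) ⟩
  sumOver (posets k) (λ Q → upsetCount Q ^ m) ∎
  where open ≡-Reasoning

-- An order is recovered by gluing its upper part and its cross relation, so orders inject into
-- pairs. The pairs are not asked to cover, which only enlarges the right side.
e≤upsetTuples : ∀ k m → e k m ≤ sumOver (posets k) (λ Q → upsetCount Q ^ m)
e≤upsetTuples k m = subst₂ _≤_ (sumOver-1 (orders k m)) (trans (sumOver-1 (pairs k m)) (length-pairs k m))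
  (sumOver-injection (λ R p → R ≈ glue (proj₁ p) (proj₂ p)) (const 1) (const 1) (orders k m) (pairs k m)
    (APP.filter⁺ _ (allRels-unique (m + k))) to (λ h h′ → ≈-trans h (≈-sym h′)))
  where
  glue⊎-cong : ∀ {Q Q′ : Rel k} {B B′ : Fin m → Fin k → Bool} → (Q , B) ≈ₚ (Q′ , B′) → glue⊎ Q B ≈ glue⊎ Q′ B′
  glue⊎-cong (eq , eqB) (inj₁ i) (inj₁ j) = refl
  glue⊎-cong (eq , eqB) (inj₁ i) (inj₂ b) = eqB i b
  glue⊎-cong (eq , eqB) (inj₂ a) (inj₁ j) = refl
  glue⊎-cong (eq , eqB) (inj₂ a) (inj₂ b) = eq a b
  to : ∀ {R} → R ∈ orders k m → ∃[ p ] p ∈ pairs k m × R ≈ glue (proj₁ p) (proj₂ p) × 1 ≤ 1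
  to R∈ with orders-sound {m} R∈
  ... | P , M with pairs-complete {m = m} (upper-poset P M) (cross-upset P M)
  ... | p , p∈ , eq = p , p∈ , ≈-trans (glue-upper-cross P M) (λ x y → glue⊎-cong eq (splitAt m x) (splitAt m y)) , ≤-refl

subsetsAvoiding : (x : Fin k) → List (Fin k → Bool)
subsetsAvoiding {k} x = filter (λ f → T? (not (f x))) (subsets k)

-- A deliberate overcount: the members of a tuple need not be up-sets, and a tuple that avoids
-- several elements is listed once for each of them.
uncovered : ∀ k m → List (Pairs k m)
uncovered k m = concatMap (λ Q → concatMap (λ x → map (Q ,_) (allFuns m (subsetsAvoiding x))) (allFin k)) (posets k)

-- An assignment of up-sets either covers Q, and then glues to an order, or
-- all its up-sets avoid some common element.
upsetTuples≤e+uncovered : ∀ k m → sumOver (posets k) (λ Q → upsetCount Q ^ m) ≤ e k m + length (uncovered k m)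
upsetTuples≤e+uncovered k m = subst₂ _≤_ (trans (sumOver-1 (pairs k m)) (length-pairs k m))
  (trans (sumOver-1 (map inj₁ (orders k m) ++ map inj₂ (uncovered k m)))
    (trans (length-++ (map inj₁ (orders k m))) (cong₂ _+_ (length-map inj₁ (orders k m)) (length-map inj₂ (uncovered k m)))))
  (sumOver-injection Match (const 1) (const 1) (pairs k m) (map inj₁ (orders k m) ++ map inj₂ (uncovered k m))
    (pairs-unique k m) to inj)
  where
  Match : Pairs k m → Rel (m + k) ⊎ Pairs k m → Set
  Match (Q , B) (inj₁ R) = glue Q B ≈ R
  Match p       (inj₂ q) = p ≈ₚ q
  inj : ∀ {p p′ r} → Match p r → Match p′ r → p ≈ₚ p′
  inj {Q , B} {Q′ , B′} {inj₁ R} h h′ =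
      ≈-trans (≈-sym (upper-glue Q B)) (≈-trans (λ a b → eq (m ↑ʳ a) (m ↑ʳ b)) (upper-glue Q′ B′))
    , ≈-trans (≈-sym (cross-glue Q B)) (≈-trans (λ i b → eq (i ↑ˡ k) (m ↑ʳ b)) (cross-glue Q′ B′))
    where eq = ≈-trans h (≈-sym h′)
  inj {r = inj₂ q} (h , hB) (h′ , hB′) = ≈-trans h (≈-sym h′) , ≈-trans hB (≈-sym hB′)
  to : ∀ {p} → p ∈ pairs k m → ∃[ r ] r ∈ (map inj₁ (orders k m) ++ map inj₂ (uncovered k m)) × Match p r × 1 ≤ 1
  to {Q , B} p∈ with pairs-sound {m = m} p∈
  ... | P , up with F.all? (λ a → F.any? (λ i → T? (B i a)))
  ... | yes cover with orders-complete {m} (glue-poset P up) (glue-minimals P up cover)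
  ... | R , R∈ , eq = inj₁ R , ∈-++⁺ˡ (∈-map⁺ inj₁ R∈) , eq , ≤-refl
  to {Q , B} p∈ | P , up | no ¬cover with F.¬∀⟶∃¬ k _ (λ a → F.any? (λ i → T? (B i a))) ¬cover
  ... | a , avoid with posets-complete P
  ... | Q′ , Q′∈ , eq with allFuns-complete m (λ i f → ∀ b → B i b ≡ f b) (subsetsAvoiding a) avoiding
    where
    not-T : ∀ b → ¬ T b → T (not b)
    not-T false _ = tt
    not-T true  h = h tt
    avoiding : ∀ i → ∃[ f ] f ∈ subsetsAvoiding a × (∀ b → B i b ≡ f b)
    avoiding i with subsets-complete (B i)
    ... | f , f∈ , eqf = f , ∈-filter⁺ _ f∈ (not-T (f a) (λ fa → avoid (i , subst T (sym (eqf a)) fa))) , eqf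
  ... | B′ , B′∈ , eqB = inj₂ (Q′ , B′) ,
    ∈-++⁺ʳ (map inj₁ (orders k m)) (∈-map⁺ inj₂ (∈-concatMap-intro Q′∈
      (∈-concatMap-intro (∈-allFin a) (∈-map⁺ (Q′ ,_) B′∈)))) , (eq , eqB) , ≤-refl

length-uncovered : ∀ k m {d} → (∀ x → length (subsetsAvoiding {k} x) ≤ d) →
  length (uncovered k m) ≤ length (posets k) * (k * d ^ m)
length-uncovered k m {d} le = begin
  length (uncovered k m)                       ≡⟨ sumOver-1 (uncovered k m) ⟨
  sumOver (uncovered k m) (const 1)            ≡⟨ sumOver-concatMap (const 1) _ (posets k) ⟩
  sumOver (posets k) _                         ≤⟨ sumOver-mono (posets k) (λ {Q} _ → inner Q) ⟩
  sumOver (posets k) (const (k * d ^ m))       ≡⟨ sumOver-const _ (posets k) ⟩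
  length (posets k) * (k * d ^ m)              ∎
  where
  open ≤-Reasoning
  inner : (Q : Rel k) → sumOver (concatMap (λ x → map (Q ,_) (allFuns m (subsetsAvoiding x))) (allFin k)) (const 1) ≤ k * d ^ m
  inner Q = begin
    sumOver (concatMap _ (allFin k)) (const 1) ≡⟨ sumOver-concatMap (const 1) (λ x → map (Q ,_) (allFuns m (subsetsAvoiding x))) (allFin k) ⟩
    sumOver (allFin k) _                       ≤⟨ sumOver-mono (allFin k) (λ {x} _ → ≤-trans (≤-reflexive
                                                   (trans (sumOver-1 (map (Q ,_) (allFuns m (subsetsAvoiding x))))
                                                   (trans (length-map _ (allFuns m (subsetsAvoiding x))) (length-allFuns m (subsetsAvoiding x)))))
                                                   (^-monoˡ-≤ m (le x))) ⟩
    sumOver (allFin k) (const (d ^ m))         ≡⟨ sumOver-const _ (allFin k) ⟩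
    length (allFin k) * d ^ m                  ≡⟨ cong (_* d ^ m) (length-tabulate (id {A = Fin k})) ⟩
    k * d ^ m                                  ∎

-- Counting subsets of Fin n

ind : Bool → ℕ
ind b = if b then 1 else 0

ind-mono : ∀ {a b} → (T a → T b) → ind a ≤ ind b
ind-mono {false}         h = z≤n
ind-mono {true}  {true}  h = ≤-refl
ind-mono {true}  {false} h = ⊥-elim (h tt)

length-filter-T? : ∀ (p : A → Bool) xs → length (filter (λ x → T? (p x)) xs) ≡ sumOver xs (ind ∘ p)
length-filter-T? p []       = refl
length-filter-T? p (x ∷ xs) with p x
... | true  = cong suc (length-filter-T? p xs)
... | false = length-filter-T? p xs

-- Rearranging a sum over subsets produces functions that agree with the expected ones only
-- pointwise, so weights have to respect that equality.
Ext : {C : Set} → ((Fin n → Bool) → C) → Set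
Ext w = ∀ {f g} → (∀ i → f i ≡ g i) → w f ≡ w g

-- Agrees with the list sum over `subsets n` by `sumOver-subsets`, but splits by computation at the
-- first coordinate, which suits induction on `n`.
∑₂ : ∀ n → ((Fin n → Bool) → ℕ) → ℕ
∑₂ zero    w = w (λ ())
∑₂ (suc n) w = ∑₂ n (λ f → w (true ◂ f)) + ∑₂ n (λ f → w (false ◂ f))

◂-cong : ∀ b {f g : Fin n → Bool} → (∀ i → f i ≡ g i) → ∀ i → (b ◂ f) i ≡ (b ◂ g) i
◂-cong b h fzero    = refl
◂-cong b h (fsuc i) = h i

∑₂-cong : ∀ n {w v : (Fin n → Bool) → ℕ} → (∀ f → w f ≡ v f) → ∑₂ n w ≡ ∑₂ n v
∑₂-cong zero    h = h _
∑₂-cong (suc n) h = cong₂ _+_ (∑₂-cong n (λ f → h _)) (∑₂-cong n (λ f → h _))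

∑₂-mono : ∀ n {w v : (Fin n → Bool) → ℕ} → (∀ f → w f ≤ v f) → ∑₂ n w ≤ ∑₂ n v
∑₂-mono zero    h = h _
∑₂-mono (suc n) h = +-mono-≤ (∑₂-mono n (λ f → h _)) (∑₂-mono n (λ f → h _))

∑₂-const : ∀ n c → ∑₂ n (const c) ≡ 2 ^ n * c
∑₂-const zero    c = sym (+-identityʳ c)
∑₂-const (suc n) c rewrite ∑₂-const n c = double (2 ^ n) c
  where
  double : ∀ a c → a * c + a * c ≡ 2 * a * c
  double = solve-∀

∑₂-+ : ∀ n (w v : (Fin n → Bool) → ℕ) → ∑₂ n (λ f → w f + v f) ≡ ∑₂ n w + ∑₂ n v
∑₂-+ zero    w v = refl
∑₂-+ (suc n) w v rewrite ∑₂-+ n (λ f → w (true ◂ f)) (λ f → v (true ◂ f))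
                       | ∑₂-+ n (λ f → w (false ◂ f)) (λ f → v (false ◂ f)) =
  interchange (∑₂ n (λ f → w (true ◂ f))) (∑₂ n (λ f → v (true ◂ f)))
              (∑₂ n (λ f → w (false ◂ f))) (∑₂ n (λ f → v (false ◂ f)))
  where
  interchange : ∀ a b c d → a + b + (c + d) ≡ a + c + (b + d)
  interchange = solve-∀

∑₂-not : ∀ n {w : (Fin n → Bool) → ℕ} → Ext w → ∑₂ n (λ f → w (not ∘ f)) ≡ ∑₂ n w
∑₂-not zero    ext = ext λ ()
∑₂-not (suc n) {w} ext = begin
  ∑₂ n (λ f → w (not ∘ (true ◂ f))) + ∑₂ n (λ f → w (not ∘ (false ◂ f)))
    ≡⟨ cong₂ _+_ (∑₂-cong n λ f → ext λ { fzero → refl ; (fsuc i) → refl })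
                 (∑₂-cong n λ f → ext λ { fzero → refl ; (fsuc i) → refl }) ⟩
  ∑₂ n (λ f → w (false ◂ (not ∘ f))) + ∑₂ n (λ f → w (true ◂ (not ∘ f)))
    ≡⟨ cong₂ _+_ (∑₂-not n (ext ∘ ◂-cong false)) (∑₂-not n (ext ∘ ◂-cong true)) ⟩
  ∑₂ n (λ f → w (false ◂ f)) + ∑₂ n (λ f → w (true ◂ f))
    ≡⟨ +-comm (∑₂ n (λ f → w (false ◂ f))) _ ⟩
  ∑₂ n (λ f → w (true ◂ f)) + ∑₂ n (λ f → w (false ◂ f)) ∎
  where open ≡-Reasoning

sumOver-subsets : ∀ n {w : (Fin n → Bool) → ℕ} → Ext w → sumOver (subsets n) w ≡ ∑₂ n w
sumOver-subsets zero {w} ext = trans (+-identityʳ _) (ext λ ())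
sumOver-subsets (suc n) {w} ext =
  trans (sumOver-++ w (map _ (subsets n)) _)
    (cong₂ _+_ (part true λ { f fzero → refl ; f (fsuc i) → refl })
      (trans (sumOver-++ w (map _ (subsets n)) [])
        (trans (+-identityʳ _) (part false λ { f fzero → refl ; f (fsuc i) → refl }))))
  where
  part : ∀ b {g : (Fin n → Bool) → Fin (suc n) → Bool} → (∀ f i → g f i ≡ (b ◂ f) i) →
    sumOver (map g (subsets n)) w ≡ ∑₂ n (λ f → w (b ◂ f))
  part b {g} h = trans (sumOver-map w g (subsets n))
    (trans (sumOver-cong (subsets n) λ {f} _ → ext (h f)) (sumOver-subsets n (ext ∘ ◂-cong b)))

set : Fin n → Bool → (Fin n → Bool) → Fin n → Bool
set x b f = updateAt f x (const b)

set-cong : (x : Fin n) → ∀ b {f g : Fin n → Bool} → (∀ i → f i ≡ g i) → ∀ i → set x b f i ≡ set x b g i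
set-cong fzero    b h fzero    = refl
set-cong fzero    b h (fsuc i) = h (fsuc i)
set-cong (fsuc x) b h fzero    = h fzero
set-cong (fsuc x) b h (fsuc i) = set-cong x b (h ∘ fsuc) i

-- Forcing the value at `x` reaches each subset exactly twice: from itself and from the subset that
-- differs from it only at `x`.
∑₂-set : ∀ n {w : (Fin n → Bool) → ℕ} → Ext w → ∀ x →
  ∑₂ n (w ∘ set x true) + ∑₂ n (w ∘ set x false) ≡ 2 * ∑₂ n w
∑₂-set (suc n) {w} ext fzero = begin
  _ ≡⟨ cong₂ _+_ (cong₂ _+_ (at0 true true) (at0 true false)) (cong₂ _+_ (at0 false true) (at0 false false)) ⟩
  (t + t) + (f + f) ≡⟨ shuffle t f ⟩
  2 * (t + f) ∎
  where
  open ≡-Reasoning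
  t f : ℕ
  t = ∑₂ n (λ f → w (true ◂ f))
  f = ∑₂ n (λ f → w (false ◂ f))
  at0 : ∀ b c → ∑₂ n (λ f → w (set fzero b (c ◂ f))) ≡ ∑₂ n (λ f → w (b ◂ f))
  at0 b c = ∑₂-cong n λ f → ext λ { fzero → refl ; (fsuc i) → refl }
  shuffle : ∀ t f → (t + t) + (f + f) ≡ 2 * (t + f)
  shuffle = solve-∀
∑₂-set (suc n) {w} ext (fsuc x) = begin
  _ ≡⟨ cong₂ _+_ (cong₂ _+_ (at true true) (at true false)) (cong₂ _+_ (at false true) (at false false)) ⟩
  (s true true + s true false) + (s false true + s false false) ≡⟨ shuffle (s true true) _ _ _ ⟩
  (s true true + s false true) + (s true false + s false false)
    ≡⟨ cong₂ _+_ (∑₂-set n (ext ∘ ◂-cong true) x) (∑₂-set n (ext ∘ ◂-cong false) x) ⟩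
  2 * ∑₂ n (λ f → w (true ◂ f)) + 2 * ∑₂ n (λ f → w (false ◂ f)) ≡⟨ *-distribˡ-+ 2 (∑₂ n _) _ ⟨
  2 * ∑₂ (suc n) w ∎
  where
  open ≡-Reasoning
  s : Bool → Bool → ℕ
  s b c = ∑₂ n (λ f → w (c ◂ set x b f))
  at : ∀ b c → ∑₂ n (λ f → w (set (fsuc x) b (c ◂ f))) ≡ s b c
  at b c = ∑₂-cong n λ f → ext λ { fzero → refl ; (fsuc i) → refl }
  shuffle : ∀ a b c d → (a + b) + (c + d) ≡ (a + c) + (b + d)
  shuffle = solve-∀

override : (Fin r → Fin k) → (Fin r → Bool) → (Fin k → Bool) → Fin k → Bool
override {zero}  ℓ b f = f
override {suc r} ℓ b f = set (ℓ fzero) (b fzero) (override (ℓ ∘ fsuc) (b ∘ fsuc) f)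

override-hit : (ℓ : Fin r → Fin k) → (∀ i j → ℓ i ≡ ℓ j → i ≡ j) → ∀ b f i → override ℓ b f (ℓ i) ≡ b i
override-hit {suc r} ℓ inj b f fzero = updateAt-updates (ℓ fzero) (override (ℓ ∘ fsuc) (b ∘ fsuc) f)
override-hit {suc r} ℓ inj b f (fsuc i) =
  trans (updateAt-minimal (ℓ (fsuc i)) (ℓ fzero) (override (ℓ ∘ fsuc) (b ∘ fsuc) f) (λ eq → case inj (fsuc i) fzero eq of λ ()))
        (override-hit (ℓ ∘ fsuc) (λ i j eq → F.suc-injective (inj (fsuc i) (fsuc j) eq)) (b ∘ fsuc) f i)

-- Overwriting a random subset at the points of `ℓ` by a random pattern keeps it uniformly
-- distributed: each subset of `Fin k` arises from 2^r pairs of a subset and a pattern.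
∑₂-override : ∀ r {k} (ℓ : Fin r → Fin k) {w} → Ext w →
  ∑₂ k (λ f → ∑₂ r (λ b → w (override ℓ b f))) ≡ 2 ^ r * ∑₂ k w
∑₂-override zero    {k} ℓ {w} ext = sym (+-identityʳ _)
∑₂-override (suc r) {k} ℓ {w} ext = begin
  ∑₂ k (λ f → ∑₂ r (λ b → w (set (ℓ fzero) true (override (ℓ ∘ fsuc) b f)))
            + ∑₂ r (λ b → w (set (ℓ fzero) false (override (ℓ ∘ fsuc) b f))))
    ≡⟨ ∑₂-+ k _ _ ⟩
  _ ≡⟨ cong₂ _+_ (∑₂-override r (ℓ ∘ fsuc) (ext ∘ set-cong (ℓ fzero) true))
                 (∑₂-override r (ℓ ∘ fsuc) (ext ∘ set-cong (ℓ fzero) false)) ⟩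
  2 ^ r * ∑₂ k (w ∘ set (ℓ fzero) true) + 2 ^ r * ∑₂ k (w ∘ set (ℓ fzero) false)
    ≡⟨ *-distribˡ-+ (2 ^ r) (∑₂ k _) _ ⟨
  2 ^ r * (∑₂ k (w ∘ set (ℓ fzero) true) + ∑₂ k (w ∘ set (ℓ fzero) false))
    ≡⟨ cong (2 ^ r *_) (∑₂-set k ext (ℓ fzero)) ⟩
  2 ^ r * (2 * ∑₂ k w) ≡⟨ shuffle (2 ^ r) (∑₂ k w) ⟩
  2 * 2 ^ r * ∑₂ k w ∎
  where
  open ≡-Reasoning
  shuffle : ∀ a b → a * (2 * b) ≡ 2 * a * b
  shuffle = solve-∀

count : ∀ n → ((Fin n → Bool) → Bool) → ℕ
count n p = ∑₂ n (ind ∘ p)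

module _ (ℓ : Fin r → Fin k) (inj : ∀ i j → ℓ i ≡ ℓ j → i ≡ j)
         {p : (Fin k → Bool) → Bool} {q : (Fin r → Bool) → Bool} (extp : Ext p) (extq : Ext q) where

  private
    restrict : ∀ b f → q (override ℓ b f ∘ ℓ) ≡ q b
    restrict b f = extq (override-hit ℓ inj b f)

  -- After the overwriting the pattern seen along `ℓ` is `b` itself, so the density of `p` is
  -- bounded by the density of `q`; both sides are multiplied by 2^(r+k).
  count-restrict-≤ : (∀ f → T (p f) → T (q (f ∘ ℓ))) → 2 ^ r * count k p ≤ 2 ^ k * count r q
  count-restrict-≤ h = begin
    2 ^ r * count k p                                         ≡⟨ ∑₂-override r ℓ (λ eq → cong ind (extp eq)) ⟨
    ∑₂ k (λ f → ∑₂ r (λ b → ind (p (override ℓ b f))))        ≤⟨ ∑₂-mono k (λ f → ∑₂-mono r (λ b →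
                                                                 ind-mono (subst T (restrict b f) ∘ h _))) ⟩
    ∑₂ k (λ f → count r q)                                    ≡⟨ ∑₂-const k _ ⟩
    2 ^ k * count r q                                         ∎
    where open ≤-Reasoning

  count-restrict-≥ : (∀ f → T (q (f ∘ ℓ)) → T (p f)) → 2 ^ k * count r q ≤ 2 ^ r * count k p
  count-restrict-≥ h = begin
    2 ^ k * count r q                                         ≡⟨ ∑₂-const k _ ⟨
    ∑₂ k (λ f → count r q)                                    ≤⟨ ∑₂-mono k (λ f → ∑₂-mono r (λ b →
                                                                 ind-mono (h _ ∘ subst T (sym (restrict b f))))) ⟩
    ∑₂ k (λ f → ∑₂ r (λ b → ind (p (override ℓ b f))))        ≡⟨ ∑₂-override r ℓ (λ eq → cong ind (extp eq)) ⟩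
    2 ^ r * count k p                                         ∎
    where open ≤-Reasoning

-- Up-set counts and their bounds by patterns

isUpset-cong : {Q Q′ : Rel k} → Q ≈ Q′ → ∀ {f g} → (∀ i → f i ≡ g i) → isUpset Q f ≡ isUpset Q′ g
isUpset-cong {Q = Q} {Q′} eqQ {f} {g} eq = T-ext
  (λ h → isUpset-intro {Q = Q′} (Upset-resp eqQ eq (isUpset-elim {Q = Q} h)))
  (λ h → isUpset-intro {Q = Q} (Upset-resp (≈-sym eqQ) (λ i → sym (eq i)) (isUpset-elim {Q = Q′} h)))

isUpset-ext : (Q : Rel k) → Ext (isUpset Q)
isUpset-ext Q = isUpset-cong {Q = Q} λ _ _ → refl

upsetCount≡count : (Q : Rel k) → upsetCount Q ≡ count k (isUpset Q)
upsetCount≡count {k} Q = trans (length-filter-T? (isUpset Q) (subsets k)) (sumOver-subsets k (λ eq → cong ind (isUpset-ext Q eq)))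

upsetCount-cong : {Q Q′ : Rel k} → Q ≈ Q′ → upsetCount Q ≡ upsetCount Q′
upsetCount-cong {k} {Q} {Q′} eq = trans (upsetCount≡count Q)
  (trans (∑₂-cong k λ f → cong ind (isUpset-cong eq λ _ → refl)) (sym (upsetCount≡count Q′)))

not-antitone : ∀ {a b} → (T a → T b) → T (not b) → T (not a)
not-antitone {false}        h _ = tt
not-antitone {true} {true}  h ()
not-antitone {true} {false} h _ = h tt

not-antitone⁻ : ∀ {a b} → (T (not a) → T (not b)) → T b → T a
not-antitone⁻ {true}          h _ = tt
not-antitone⁻ {false} {true}  h _ = ⊥-elim (h tt)
not-antitone⁻ {false} {false} h ()

-- Complementation exchanges the up-sets of `Q` with those of the reversed order. This reduces Λ to
-- V and down-stars to up-stars.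
upsetCount-flip : (Q : Rel k) → upsetCount (flip Q) ≡ upsetCount Q
upsetCount-flip {k} Q = begin
  upsetCount (flip Q)                      ≡⟨ upsetCount≡count (flip Q) ⟩
  ∑₂ k (λ f → ind (isUpset (flip Q) f))    ≡⟨ ∑₂-cong k (λ f → cong ind (complement f)) ⟩
  ∑₂ k (λ f → ind (isUpset Q (not ∘ f)))   ≡⟨ ∑₂-not k (λ eq → cong ind (isUpset-ext Q eq)) ⟩
  count k (isUpset Q)                      ≡⟨ upsetCount≡count Q ⟨
  upsetCount Q                             ∎
  where
  open ≡-Reasoning
  complement : ∀ f → isUpset (flip Q) f ≡ isUpset Q (not ∘ f)
  complement f = T-ext
    (λ h → isUpset-intro {Q = Q} λ {x} {y} q → not-antitone {f y} {f x} (isUpset-elim {Q = flip Q} h q))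
    (λ h → isUpset-intro {Q = flip Q} λ {x} {y} q → not-antitone⁻ {f y} {f x} (isUpset-elim {Q = Q} h q))

closed : List (Fin r × Fin r) → (Fin r → Bool) → Bool
closed []            b = true
closed ((i , j) ∷ E) b = (b i ⇒ᵇ b j) ∧ closed E b

closed-ext : (E : List (Fin r × Fin r)) → Ext (closed E)
closed-ext []            eq = refl
closed-ext ((i , j) ∷ E) eq = cong₂ _∧_ (cong₂ _⇒ᵇ_ (eq i) (eq j)) (closed-ext E eq)

closed-intro : {b : Fin r → Bool} → ∀ {E} → All (λ (i , j) → T (b i) → T (b j)) E → T (closed E b)
closed-intro []       = tt
closed-intro (h ∷ hs) = Equivalence.from T-∧ (⇒ᵇ-intro h , closed-intro hs)

closed-elim : {b : Fin r → Bool} → ∀ E → T (closed E b) → All (λ (i , j) → T (b i) → T (b j)) E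
closed-elim []      h = []
closed-elim (_ ∷ E) h with Equivalence.to T-∧ h
... | p , q = ⇒ᵇ-elim p ∷ closed-elim E q

-- The bound 2^(k-1) in doubled form, which is also right for k = 0.
Few : Rel k → Set
Few {k} Q = 2 * upsetCount Q ≤ 2 ^ k

-- An up-set shows on the points of `v` a pattern that respects the edges `E`. That at most half of
-- the 2^r patterns do so is a closed computation, hence the hypothesis in the form `T (… ≤ᵇ …)`,
-- which `tt` proves for concrete `E`.
pattern-few : (Q : Rel k) (v : Vec (Fin k) r) → Unique v → ∀ E →
  All (λ (i , j) → T (Q (lookup v i) (lookup v j))) E →
  T (2 * count r (closed E) ≤ᵇ 2 ^ r) → Few Q
pattern-few {k} {r} Q v v! E edges le = *-cancelˡ-≤ (2 ^ r) {{m^n≢0 2 r}} (begin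
  2 ^ r * (2 * upsetCount Q)         ≡⟨ cong (λ u → 2 ^ r * (2 * u)) (upsetCount≡count Q) ⟩
  2 ^ r * (2 * count k (isUpset Q))  ≡⟨ shuffle (2 ^ r) 2 ⟩
  2 * (2 ^ r * count k (isUpset Q))  ≤⟨ *-monoʳ-≤ 2 (count-restrict-≤ (lookup v) (lookup-injective v!) (isUpset-ext Q) (closed-ext E)
                                          λ f h → closed-intro (All.map (λ q → isUpset-elim {Q = Q} h q) edges)) ⟩
  2 * (2 ^ k * count r (closed E))   ≡⟨ shuffle 2 (2 ^ k) ⟩
  2 ^ k * (2 * count r (closed E))   ≤⟨ *-monoʳ-≤ (2 ^ k) (≤ᵇ⇒≤ _ _ le) ⟩
  2 ^ k * 2 ^ r                      ≡⟨ *-comm (2 ^ k) _ ⟩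
  2 ^ r * 2 ^ k                      ∎)
  where
  open ≤-Reasoning
  shuffle : ∀ a b {c} → a * (b * c) ≡ b * (a * c)
  shuffle a b {c} = trans (sym (*-assoc a b c)) (trans (cong (_* c) (*-comm a b)) (*-assoc b a c))

-- Restriction to the single point `x`, where one of the two patterns is allowed. This bounds the
-- tuples that do not cover.
length-subsetsAvoiding : (x : Fin k) → 2 * length (subsetsAvoiding x) ≤ 2 ^ k
length-subsetsAvoiding {k} x = begin
  2 * length (subsetsAvoiding x)  ≡⟨ cong (2 *_) (length-filter-T? (λ f → not (f x)) (subsets k)) ⟩
  2 * sumOver (subsets k) _       ≡⟨ cong (2 *_) (sumOver-subsets k (λ eq → cong (ind ∘ not) (eq x))) ⟩
  2 * count k (λ f → not (f x))   ≤⟨ count-restrict-≤ {r = 1} (const x) (λ { 0F 0F _ → refl })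
                                       {q = λ b → not (b 0F)} (λ eq → cong not (eq x)) (λ eq → cong not (eq 0F)) (λ f → id) ⟩
  2 ^ k * 1                       ≡⟨ *-identityʳ _ ⟩
  2 ^ k                           ∎
  where open ≤-Reasoning

size : (Fin k → Bool) → ℕ
size {zero}  S = 0
size {suc k} S = ind (S fzero) + size (S ∘ fsuc)

includes : (Fin k → Bool) → (Fin k → Bool) → Bool
includes {k} S f = ∀ᶠ k λ x → S x ⇒ᵇ f x

includes-ext : (S : Fin k → Bool) → Ext (includes S)
includes-ext {k} S eq = T-ext
  (λ h → ∀ᶠ-intro k λ x → subst (λ b → T (S x ⇒ᵇ b)) (eq x) (∀ᶠ-elim k h x))
  (λ h → ∀ᶠ-intro k λ x → subst (λ b → T (S x ⇒ᵇ b)) (sym (eq x)) (∀ᶠ-elim k h x))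

-- Each element of `S` fixes one coordinate and so halves the count; the product form avoids the
-- exponent k - `size S`.
count-includes : ∀ k (S : Fin k → Bool) → 2 ^ size S * count k (includes S) ≡ 2 ^ k
count-includes zero    S = refl
count-includes (suc k) S with S fzero
... | true  = begin
  2 * 2 ^ s * (count k (includes (S ∘ fsuc)) + ∑₂ k (const 0)) ≡⟨ cong (λ c → 2 * 2 ^ s * (count k (includes (S ∘ fsuc)) + c)) (trans (∑₂-const k 0) (*-zeroʳ (2 ^ k))) ⟩
  2 * 2 ^ s * (count k (includes (S ∘ fsuc)) + 0)              ≡⟨ cong (2 * 2 ^ s *_) (+-identityʳ _) ⟩
  2 * 2 ^ s * count k (includes (S ∘ fsuc))                    ≡⟨ *-assoc 2 (2 ^ s) _ ⟩
  2 * (2 ^ s * count k (includes (S ∘ fsuc)))                  ≡⟨ cong (2 *_) (count-includes k (S ∘ fsuc)) ⟩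
  2 * 2 ^ k                                                    ∎
  where
  open ≡-Reasoning
  s = size (S ∘ fsuc)
... | false = begin
  2 ^ s * (c + c)  ≡⟨ shuffle (2 ^ s) c ⟩
  2 * (2 ^ s * c)  ≡⟨ cong (2 *_) (count-includes k (S ∘ fsuc)) ⟩
  2 * 2 ^ k        ∎
  where
  open ≡-Reasoning
  s = size (S ∘ fsuc)
  c = count k (includes (S ∘ fsuc))
  shuffle : ∀ a c → a * (c + c) ≡ 2 * (a * c)
  shuffle = solve-∀

-- The exceptional posets and their up-set counts

antichain : Rel k
antichain x y = x ≟ᶠ y

-- `S` is meant to contain the centre `c`, so that `size S` is the number of elements of the star
-- and not of its rays.
upStar : (Fin k → Bool) → Fin k → Rel k
upStar S c x y = (x ≟ᶠ y) ∨ ((x ≟ᶠ c) ∧ S y)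

downStar : (Fin k → Bool) → Fin k → Rel k
downStar S c = flip (upStar S c)

twoChains : Fin k → Fin k → Fin k → Fin k → Rel k
twoChains a b c d x y = (x ≟ᶠ y) ∨ (((x ≟ᶠ a) ∧ (y ≟ᶠ b)) ∨ ((x ≟ᶠ c) ∧ (y ≟ᶠ d)))

upStar-elim : {S : Fin k → Bool} {c x y : Fin k} → T (upStar S c x y) → x ≡ y ⊎ (x ≡ c × T (S y))
upStar-elim h with Equivalence.to T-∨ h
... | inj₁ p = inj₁ (≟ᶠ-elim p)
... | inj₂ p with Equivalence.to T-∧ p
... | q , r = inj₂ (≟ᶠ-elim q , r)

upStar-intro : {S : Fin k → Bool} {c x y : Fin k} → x ≡ y ⊎ (x ≡ c × T (S y)) → T (upStar S c x y)
upStar-intro (inj₁ p)       = Equivalence.from T-∨ (inj₁ (≟ᶠ-intro p))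
upStar-intro {c = c} {x} {y} (inj₂ (p , q)) = Equivalence.from (T-∨ {x ≟ᶠ y}) (inj₂ (Equivalence.from T-∧ (≟ᶠ-intro p , q)))

twoChains-elim : {a b c d x y : Fin k} → T (twoChains a b c d x y) → x ≡ y ⊎ (x ≡ a × y ≡ b) ⊎ (x ≡ c × y ≡ d)
twoChains-elim h with Equivalence.to T-∨ h
... | inj₁ p = inj₁ (≟ᶠ-elim p)
... | inj₂ p with Equivalence.to T-∨ p
... | inj₁ q with Equivalence.to T-∧ q
... | s , t = inj₂ (inj₁ (≟ᶠ-elim s , ≟ᶠ-elim t))
twoChains-elim h | inj₂ p | inj₂ q with Equivalence.to T-∧ q
... | s , t = inj₂ (inj₂ (≟ᶠ-elim s , ≟ᶠ-elim t))

twoChains-intro : {a b c d x y : Fin k} → x ≡ y ⊎ (x ≡ a × y ≡ b) ⊎ (x ≡ c × y ≡ d) → T (twoChains a b c d x y)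
twoChains-intro (inj₁ p) = Equivalence.from T-∨ (inj₁ (≟ᶠ-intro p))
twoChains-intro {a = a} {b} {c} {d} {x} {y} (inj₂ (inj₁ (p , q))) = Equivalence.from (T-∨ {x ≟ᶠ y})
  (inj₂ (Equivalence.from T-∨ (inj₁ (Equivalence.from T-∧ (≟ᶠ-intro p , ≟ᶠ-intro q)))))
twoChains-intro {a = a} {b} {c} {d} {x} {y} (inj₂ (inj₂ (p , q))) = Equivalence.from (T-∨ {x ≟ᶠ y})
  (inj₂ (Equivalence.from (T-∨ {(x ≟ᶠ a) ∧ (y ≟ᶠ b)}) (inj₂ (Equivalence.from T-∧ (≟ᶠ-intro p , ≟ᶠ-intro q)))))

count-true : ∀ {p : (Fin k → Bool) → Bool} → (∀ f → T (p f)) → count k p ≡ 2 ^ k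
count-true {k} {p} h = trans (∑₂-cong k λ f → cong ind (Equivalence.to T-≡ (h f)))
  (trans (∑₂-const k 1) (*-identityʳ (2 ^ k)))

count-false : ∀ {p : (Fin k → Bool) → Bool} → (∀ f → ¬ T (p f)) → count k p ≡ 0
count-false {k} {p} h = trans (∑₂-cong k λ f → cong ind (T-ext {p f} {false} (h f) (λ ())))
  (trans (∑₂-const k 0) (*-zeroʳ (2 ^ k)))

upsetCount-antichain : ∀ k → upsetCount (antichain {k}) ≡ 2 ^ k
upsetCount-antichain k = trans (upsetCount≡count (antichain {k}))
  (count-true {k} {isUpset antichain} λ f → isUpset-intro {Q = antichain} λ {x} {y} q → subst (T ∘ f) (≟ᶠ-elim {i = x} {y} q))

-- An up-set of the star either omits the centre and is then arbitrary, or
-- contains all of S.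
upsetCount-upStar : ∀ {k} (S : Fin k → Bool) {c} → T (S c) →
  2 ^ size S * (2 * upsetCount (upStar S c)) ≡ 2 ^ size S * 2 ^ k + 2 * 2 ^ k
upsetCount-upStar {k} S {c} Sc = begin
  2 ^ s * (2 * upsetCount (upStar S c))  ≡⟨ cong (λ u → 2 ^ s * (2 * u)) (upsetCount≡count (upStar S c)) ⟩
  2 ^ s * (2 * count k up)               ≡⟨ cong (2 ^ s *_) (∑₂-set k (λ eq → cong ind (isUpset-ext (upStar S c) eq)) c) ⟨
  2 ^ s * (count k (up ∘ set c true) + count k (up ∘ set c false))
    ≡⟨ cong (2 ^ s *_) (cong₂ _+_ (∑₂-cong k λ f → cong ind (with-centre f)) (count-true without-centre)) ⟩
  2 ^ s * (i + 2 ^ k)                    ≡⟨ cong (λ i → 2 ^ s * (i + 2 ^ k)) i≡2j ⟩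
  2 ^ s * (2 * j + 2 ^ k)                ≡⟨ shuffle (2 ^ s) j (2 ^ k) ⟩
  2 ^ s * 2 ^ k + 2 * (2 ^ s * j)        ≡⟨ cong (λ x → 2 ^ s * 2 ^ k + 2 * x) (count-includes k S) ⟩
  2 ^ s * 2 ^ k + 2 * 2 ^ k              ∎
  where
  open ≡-Reasoning
  s = size S
  up = isUpset (upStar S c)
  i = count k (includes S ∘ set c true)
  j = count k (includes S)
  shuffle : ∀ a j b → a * (2 * j + b) ≡ a * b + 2 * (a * j)
  shuffle = solve-∀
  set-true : ∀ f → set c true f c ≡ true
  set-true f = updateAt-updates c f
  set-false : ∀ f → set c false f c ≡ false
  set-false f = updateAt-updates c f
  i≡2j : i ≡ 2 * j
  -- A set that includes `S` contains `c`, so of the two sums in `∑₂-set` the one with `c` removed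
  -- vanishes.
  i≡2j = trans (sym (+-identityʳ i)) (trans
    (cong (i +_) (sym (count-false λ f h → subst T (set-false f) (⇒ᵇ-elim (∀ᶠ-elim k h c) Sc))))
    (∑₂-set k (λ eq → cong ind (includes-ext S eq)) c))
  with-centre : ∀ f → up (set c true f) ≡ includes S (set c true f)
  with-centre f = T-ext
    (λ h → ∀ᶠ-intro k λ x → ⇒ᵇ-intro λ Sx → isUpset-elim {Q = upStar S c} h {c} {x}
      (upStar-intro {S = S} {c} {c} {x} (inj₂ (refl , Sx))) (subst T (sym (set-true f)) tt))
    (λ h → isUpset-intro {Q = upStar S c} λ {x} {y} q fx → case upStar-elim {S = S} {c} {x} {y} q of λ
      { (inj₁ refl) → fx ; (inj₂ (_ , Sy)) → ⇒ᵇ-elim (∀ᶠ-elim k h y) Sy })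
  without-centre : ∀ f → T (up (set c false f))
  without-centre f = isUpset-intro {Q = upStar S c} λ {x} {y} q fx → case upStar-elim {S = S} {c} {x} {y} q of λ
      { (inj₁ refl) → fx ; (inj₂ (refl , _)) → ⊥-elim (subst T (set-false f) fx) }

-- Being an up-set depends only on the four points, so the restriction bound holds in both
-- directions. Each chain allows 3 of its 4 patterns, together 9 of 16.
upsetCount-twoChains : {a b c d : Fin k} → Unique (a ∷ b ∷ c ∷ d ∷ []) →
  16 * upsetCount (twoChains a b c d) ≡ 2 ^ k * 9
upsetCount-twoChains {k} {a} {b} {c} {d} v! = trans (cong (16 *_) (upsetCount≡count Q))
  (≤-antisym
    (count-restrict-≤ (lookup v) (lookup-injective v!) (isUpset-ext Q) (closed-ext E) λ f h →
      closed-intro {b = f ∘ lookup v} {E} ((isUpset-elim {Q = Q} h {a} {b} (twoChains-intro {a = a} {b} {c} {d} (inj₂ (inj₁ (refl , refl)))))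
        ∷ (isUpset-elim {Q = Q} h {c} {d} (twoChains-intro {a = a} {b} {c} {d} (inj₂ (inj₂ (refl , refl))))) ∷ []))
    (count-restrict-≥ (lookup v) (lookup-injective v!) (isUpset-ext Q) (closed-ext E) λ f h →
      isUpset-intro {Q = Q} λ {x} {y} q fx → case (twoChains-elim {a = a} {b} {c} {d} {x} {y} q , closed-elim {b = f ∘ lookup v} E h) of λ
        { (inj₁ refl , _) → fx
        ; (inj₂ (inj₁ (refl , refl)) , (i ∷ _)) → i fx
        ; (inj₂ (inj₂ (refl , refl)) , (_ ∷ i ∷ _)) → i fx }))
  where
  Q = twoChains a b c d
  v = a ∷ b ∷ c ∷ d ∷ []
  E : List (Fin 4 × Fin 4)
  E = (0F , 1F) ∷ (2F , 3F) ∷ []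

-- Posets with more than 2^(k-1) up-sets

module _ {Q : Rel k} (P : IsPoset Q) where

  infix 4 _⊏_
  _⊏_ : Fin k → Fin k → Set
  x ⊏ y = T (Q x y) × x ≢ y

  ⊏? : ∀ x y → Dec (x ⊏ y)
  ⊏? x y = T? (Q x y) ×-dec ¬? (x F.≟ y)

  -- A 3-chain has 4 up-sets, out of 8 patterns. Antisymmetry separates its two ends.
  chain-few : ∀ {x y z} → x ⊏ y → y ⊏ z → Few Q
  chain-few {x} {y} {z} (xy , x≢y) (yz , y≢z) = pattern-few Q (x ∷ y ∷ z ∷ [])
    ((x≢y ∷ (λ { refl → x≢y (antisym P xy yz) }) ∷ []) ∷ (y≢z ∷ []) ∷ [] ∷ [])
    ((0F , 1F) ∷ (1F , 2F) ∷ []) (xy ∷ yz ∷ []) tt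

  -- The N allows 8 of 16 patterns: 2 that contain `x`, and 2 times 3 that do not.
  N-few : ∀ {x y y′ p} → x ⊏ y → x ⊏ y′ → p ⊏ y → y ≢ y′ → x ≢ p → y′ ≢ p → Few Q
  N-few {x} {y} {y′} {p} (xy , x≢y) (xy′ , x≢y′) (py , p≢y) y≢y′ x≢p y′≢p =
    pattern-few Q (x ∷ y ∷ y′ ∷ p ∷ [])
      ((x≢y ∷ x≢y′ ∷ x≢p ∷ []) ∷ (y≢y′ ∷ ≢-sym p≢y ∷ []) ∷ (y′≢p ∷ []) ∷ [] ∷ [])
      ((0F , 1F) ∷ (0F , 2F) ∷ (3F , 1F) ∷ []) (xy ∷ xy′ ∷ py ∷ []) tt

  -- The V allows 5 of 8 patterns and the separate edge 3 of 4, together 15 of 32.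
  V+edge-few : ∀ {x y y′ p q} → x ⊏ y → x ⊏ y′ → p ⊏ q → y ≢ y′ →
    x ≢ p → y ≢ p → y′ ≢ p → x ≢ q → y ≢ q → y′ ≢ q → Few Q
  V+edge-few {x} {y} {y′} {p} {q} (xy , x≢y) (xy′ , x≢y′) (pq , p≢q) y≢y′ x≢p y≢p y′≢p x≢q y≢q y′≢q =
    pattern-few Q (x ∷ y ∷ y′ ∷ p ∷ q ∷ [])
      ((x≢y ∷ x≢y′ ∷ x≢p ∷ x≢q ∷ []) ∷ (y≢y′ ∷ y≢p ∷ y≢q ∷ []) ∷ (y′≢p ∷ y′≢q ∷ []) ∷ (p≢q ∷ []) ∷ [] ∷ [])
      ((0F , 1F) ∷ (0F , 2F) ∷ (3F , 4F) ∷ []) (xy ∷ xy′ ∷ pq ∷ []) tt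

  Disjoint : (x y p q : Fin k) → Set
  Disjoint x y p q = x ≢ p × x ≢ q × y ≢ p × y ≢ q

  -- Here 27 of 64 patterns remain. Two edges would not suffice, since 9 of 16 exceeds one half.
  edges³-few : ∀ {x y p q r s} → x ⊏ y → p ⊏ q → r ⊏ s →
    Disjoint x y p q → Disjoint x y r s → Disjoint p q r s → Few Q
  edges³-few {x} {y} {p} {q} {r} {s} (xy , x≢y) (pq , p≢q) (rs , r≢s)
    (xp , xq , yp , yq) (xr , xs , yr , ys) (pr , ps , qr , qs) =
    pattern-few Q (x ∷ y ∷ p ∷ q ∷ r ∷ s ∷ [])
      ((x≢y ∷ xp ∷ xq ∷ xr ∷ xs ∷ []) ∷ (yp ∷ yq ∷ yr ∷ ys ∷ []) ∷ (p≢q ∷ pr ∷ ps ∷ []) ∷ (qr ∷ qs ∷ [])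
        ∷ (r≢s ∷ []) ∷ [] ∷ [])
      ((0F , 1F) ∷ (2F , 3F) ∷ (4F , 5F) ∷ []) (xy ∷ pq ∷ rs ∷ []) tt

  star-if : ∀ x → (∀ {p q} → p ⊏ q → p ≡ x) → Q ≈ upStar (Q x) x
  star-if x h a b = T-ext to from
    where
    to : T (Q a b) → T (upStar (Q x) x a b)
    to ab with a F.≟ b
    ... | yes a≡b = upStar-intro {S = Q x} {x} {a} {b} (inj₁ a≡b)
    ... | no  a≢b with h (ab , a≢b)
    ... | refl = upStar-intro {S = Q x} {x} {a} {b} (inj₂ (refl , ab))
    from : T (upStar (Q x) x a b) → T (Q a b)
    from s with upStar-elim {S = Q x} {x} {a} {b} s
    ... | inj₁ refl       = reflexive P a
    ... | inj₂ (refl , q) = q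

  -- An edge that does not start at the centre of the V either continues or precedes one of its
  -- edges, giving a 3-chain, or ends at one of its tips, giving an N, or misses the V altogether.
  not-centred-few : ∀ {x y y′ p q} → x ⊏ y → x ⊏ y′ → y ≢ y′ → p ⊏ q → p ≢ x → Few Q
  not-centred-few {x} {y} {y′} {p} {q} xy xy′ y≢y′ pq p≢x
    with q F.≟ x | p F.≟ y | p F.≟ y′ | q F.≟ y | q F.≟ y′
  ... | yes refl | _        | _        | _        | _        = chain-few pq xy
  ... | no _     | yes refl | _        | _        | _        = chain-few xy pq
  ... | no _     | no _     | yes refl | _        | _        = chain-few xy′ pq
  ... | no _     | no _     | no p≢y′  | yes refl | _        = N-few xy xy′ pq y≢y′ (≢-sym p≢x) (≢-sym p≢y′)
  ... | no _     | no p≢y   | no _     | no _     | yes refl = N-few xy′ xy pq (≢-sym y≢y′) (≢-sym p≢x) (≢-sym p≢y)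
  ... | no q≢x   | no p≢y   | no p≢y′  | no q≢y   | no q≢y′  =
    V+edge-few xy xy′ pq y≢y′ (≢-sym p≢x) (≢-sym p≢y) (≢-sym p≢y′) (≢-sym q≢x) (≢-sym q≢y) (≢-sym q≢y′)

  vee : ∀ {x y y′} → x ⊏ y → x ⊏ y′ → y ≢ y′ → Few Q ⊎ Q ≈ upStar (Q x) x
  vee {x} xy xy′ y≢y′ with F.any? (λ p → F.any? λ q → ⊏? p q ×-dec ¬? (p F.≟ x))
  ... | yes (p , q , pq , p≢x) = inj₁ (not-centred-few xy xy′ y≢y′ pq p≢x)
  ... | no  none = inj₂ (star-if x λ {p} {q} pq → decidable-stable (p F.≟ x) λ p≢x → none (p , q , pq , p≢x))

  Vee : Set
  Vee = ∃[ x ] ∃[ y ] ∃[ y′ ] x ⊏ y × x ⊏ y′ × y ≢ y′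

  Vee? : Dec Vee
  Vee? = F.any? λ x → F.any? λ y → F.any? λ y′ → ⊏? x y ×-dec (⊏? x y′ ×-dec ¬? (y F.≟ y′))

data Shape {k} (Q : Rel k) : Set where
  few  : Few Q → Shape Q
  anti : Q ≈ antichain → Shape Q
  up   : ∀ S c y → T (S c) → T (S y) → c ≢ y → Q ≈ upStar S c → Shape Q
  down : ∀ S c y y′ → T (S c) → T (S y) → T (S y′) → c ≢ y → c ≢ y′ → y ≢ y′ → Q ≈ downStar S c → Shape Q
  two  : ∀ a b c d → Unique (a ∷ b ∷ c ∷ d ∷ []) → Q ≈ twoChains a b c d → Shape Q

flip-poset : {Q : Rel k} → IsPoset Q → IsPoset (flip Q)
flip-poset P = record
  { reflexive  = reflexive P
  ; antisym    = λ p q → antisym P q p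
  ; transitive = λ p q → transitive P q p
  }

module _ {Q : Rel k} (P : IsPoset Q) (noV : ¬ Vee P) (noΛ : ¬ Vee (flip-poset P)) where

  private
    _◁_ : Fin k → Fin k → Set
    _◁_ = _⊏_ P

  -- Two different edges with a common lower end form a V, with a common upper end a Λ, and head to
  -- tail a 3-chain.
  disjoint : ∀ {x y p q} → x ◁ y → p ◁ q → ¬ (p ≡ x × q ≡ y) → Few Q ⊎ Disjoint P x y p q
  disjoint {x} {y} {p} {q} xy pq ne with q F.≟ x | p F.≟ y
  ... | yes refl | _        = inj₁ (chain-few P pq xy)
  ... | no _     | yes refl = inj₁ (chain-few P xy pq)
  ... | no q≢x   | no p≢y   = inj₂ (x≢p , ≢-sym q≢x , ≢-sym p≢y , y≢q)
    where
    x≢p : x ≢ p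
    x≢p refl = noV (x , y , q , xy , pq , λ y≡q → ne (refl , sym y≡q))
    y≢q : y ≢ q
    y≢q refl = noΛ (y , x , p , (proj₁ xy , ≢-sym (proj₂ xy)) , (proj₁ pq , ≢-sym (proj₂ pq)) , λ x≡p → ne (sym x≡p , refl))

  -- The strict comparabilities are now a matching, unless a 3-chain occurs. No edge gives the
  -- antichain, one edge a star on two elements, two edges the two chains, and a third edge leaves
  -- too few up-sets.
  matching-shape : Shape Q
  matching-shape with F.any? (λ x → F.any? λ y → ⊏? P x y)
  ... | no none = anti λ a b → T-ext
    (λ ab → ≟ᶠ-intro (decidable-stable (a F.≟ b) λ a≢b → none (a , b , ab , a≢b)))
    (λ h → subst (T ∘ Q a) (≟ᶠ-elim {i = a} {b} h) (reflexive P a))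
  ... | yes (x , y , xy) with F.any? (λ p → F.any? λ q → ⊏? P p q ×-dec ¬? ((p F.≟ x) ×-dec (q F.≟ y)))
  ... | no none = up (Q x) x y (reflexive P x) (proj₁ xy) (proj₂ xy) (star-if P x λ {p} {q} pq →
    decidable-stable (p F.≟ x) λ p≢x → none (p , q , pq , p≢x ∘ proj₁))
  ... | yes (p , q , pq , ne) with disjoint xy pq ne
  ... | inj₁ f = few f
  ... | inj₂ dis@(xp , xq , yp , yq)
      with F.any? (λ r → F.any? λ s → ⊏? P r s ×-dec (¬? ((r F.≟ x) ×-dec (s F.≟ y)) ×-dec ¬? ((r F.≟ p) ×-dec (s F.≟ q))))
  ... | yes (r , s , rs , ne₁ , ne₂) with disjoint xy rs ne₁ | disjoint pq rs ne₂
  ... | inj₁ f    | _         = few f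
  ... | inj₂ _    | inj₁ f    = few f
  ... | inj₂ dis₁ | inj₂ dis₂ = few (edges³-few P xy pq rs dis dis₁ dis₂)
  matching-shape | yes (x , y , xy) | yes (p , q , pq , ne) | inj₂ (xp , xq , yp , yq) | no none =
    two x y p q ((proj₂ xy ∷ xp ∷ xq ∷ []) ∷ (yp ∷ yq ∷ []) ∷ (proj₂ pq ∷ []) ∷ [] ∷ [])
      λ a b → T-ext (twoChains-intro {a = x} {y} {p} {q} {a} {b} ∘ to a b) (from a b ∘ twoChains-elim {a = x} {y} {p} {q} {a} {b})
    where
    to : ∀ a b → T (Q a b) → a ≡ b ⊎ (a ≡ x × b ≡ y) ⊎ (a ≡ p × b ≡ q)
    to a b ab with a F.≟ b | (a F.≟ x) ×-dec (b F.≟ y) | (a F.≟ p) ×-dec (b F.≟ q)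
    ... | yes e  | _     | _     = inj₁ e
    ... | no _   | yes e | _     = inj₂ (inj₁ e)
    ... | no _   | no _  | yes e = inj₂ (inj₂ e)
    ... | no a≢b | no n₁ | no n₂ = ⊥-elim (none (a , b , (ab , a≢b) , n₁ , n₂))
    from : ∀ a b → a ≡ b ⊎ (a ≡ x × b ≡ y) ⊎ (a ≡ p × b ≡ q) → T (Q a b)
    from a b (inj₁ refl)                 = reflexive P a
    from a b (inj₂ (inj₁ (refl , refl))) = proj₁ xy
    from a b (inj₂ (inj₂ (refl , refl))) = proj₁ pq

-- A Λ is a V of the reversed order. A poset with either one is a star or has few up-sets; without
-- both, `matching-shape` applies.
shape : {Q : Rel k} → IsPoset Q → Shape Q
shape {k} {Q} P with Vee? P
... | yes (x , y , y′ , xy , xy′ , y≢y′) with vee P xy xy′ y≢y′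
... | inj₁ f  = few f
... | inj₂ eq = up (Q x) x y (reflexive P x) (proj₁ xy) (proj₂ xy) eq
shape {k} {Q} P | no noV with Vee? (flip-poset P)
... | no noΛ = matching-shape P noV noΛ
... | yes (x , y , y′ , xy , xy′ , y≢y′) with vee (flip-poset P) xy xy′ y≢y′
... | inj₁ f  = few (subst (λ u → 2 * u ≤ 2 ^ k) (upsetCount-flip Q) f)
... | inj₂ eq = down (flip Q x) x y y′ (reflexive P x) (proj₁ xy) (proj₁ xy′) (proj₂ xy) (proj₂ xy′) y≢y′ (λ a b → eq b a)

-- Codes for the stars and the pairs of chains

elems : (Fin k → Bool) → List (Fin k)
elems {k} S = filter (λ x → T? (S x)) (allFin k)

elems-sound : {S : Fin k → Bool} {x : Fin k} → x ∈ elems S → T (S x)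
elems-sound {k} {S} x∈ = proj₂ (∈-filter⁻ (λ x → T? (S x)) {xs = allFin k} x∈)

elems-complete : {S : Fin k → Bool} {x : Fin k} → T (S x) → x ∈ elems S
elems-complete {S = S} {x} Sx = ∈-filter⁺ (λ x → T? (S x)) (∈-allFin x) Sx

elems-sorted : (S : Fin k → Bool) → AllPairs (λ x y → toℕ x < toℕ y) (elems S)
elems-sorted {k} S = APP.filter⁺ (λ x → T? (S x)) (APP.tabulate⁺-< {f = id {A = Fin k}} id)

elems-unique : (S : Fin k → Bool) → AllPairs _≢_ (elems S)
elems-unique S = AP.map (λ lt eq → <-irrefl (cong toℕ eq) lt) (elems-sorted S)

length-elems : (S : Fin k → Bool) → length (elems S) ≡ size S
length-elems {k} S = trans (length-filter-T? S (allFin k)) (go k id)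
  where
  go : ∀ n (g : Fin n → Fin k) → sumOver (tabulate g) (ind ∘ S) ≡ size (S ∘ g)
  go zero    g = refl
  go (suc n) g = cong (ind (S (g fzero)) +_) (go n (g ∘ fsuc))

size-cong : {S S′ : Fin k → Bool} → (∀ x → S x ≡ S′ x) → size S ≡ size S′
size-cong {zero}  eq = refl
size-cong {suc k} eq = cong₂ _+_ (cong ind (eq fzero)) (size-cong (eq ∘ fsuc))

size≤ : (S : Fin k → Bool) → size S ≤ k
size≤ {zero}  S = z≤n
size≤ {suc k} S with S fzero
... | true  = s≤s (size≤ (S ∘ fsuc))
... | false = m≤n⇒m≤1+n (size≤ (S ∘ fsuc))

unique-length-≤ : ∀ {xs ys : List A} → AllPairs _≢_ xs → (∀ {x} → x ∈ xs → x ∈ ys) → length xs ≤ length ys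
unique-length-≤ {xs = xs} {ys} xs! sub = subst₂ _≤_ (sumOver-1 xs) (sumOver-1 ys)
  (sumOver-injection _≡_ (const 1) (const 1) xs ys xs! (λ x∈ → _ , sub x∈ , refl , ≤-refl) (λ { refl refl → refl }))

another : ∀ {L : List (Fin k)} → AllPairs _≢_ L → 2 ≤ length L → ∀ c → ∃[ y ] y ∈ L × c ≢ y
another {L = x ∷ y ∷ L} ((x≢y ∷ _) ∷ _) _ c with c F.≟ x
... | yes refl = y , there (here refl) , x≢y
... | no  c≢x  = x , here refl , c≢x
another {L = x ∷ []} _ (s≤s ()) c

twoOthers : ∀ {L : List (Fin k)} → AllPairs _≢_ L → 3 ≤ length L → ∀ c →
  ∃[ y ] ∃[ y′ ] y ∈ L × y′ ∈ L × c ≢ y × c ≢ y′ × y ≢ y′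
twoOthers {L = x ∷ L} (x# ∷ L!) (s≤s 2≤) c with c F.≟ x
twoOthers {L = x ∷ y ∷ w ∷ L} ((x≢y ∷ x≢w ∷ _) ∷ (y≢w ∷ _) ∷ _) (s≤s 2≤) c | yes refl =
  y , w , there (here refl) , there (there (here refl)) , x≢y , x≢w , y≢w
twoOthers {L = x ∷ y ∷ []} _ (s≤s (s≤s ())) c | yes refl
... | no c≢x with another L! 2≤ c
... | y , y∈ , c≢y = x , y , here refl , there y∈ , c≢x , c≢y , All.lookup x# y∈

-- A code `two` carries its support `S` along with the four points that determine it, so that codes
-- of every type can be grouped by `S` and counted by `size S`.
data Code (k : ℕ) : Set where
  anti     : Code k
  up down  : (Fin k → Bool) → Fin k → Code k
  two      : (Fin k → Bool) → (a b c d : Fin k) → Code k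

rel : Code k → Rel k
rel anti            = antichain
rel (up S c)        = upStar S c
rel (down S c)      = downStar S c
rel (two S a b c d) = twoChains a b c d

_~_ : Code k → Code k → Set
anti          ~ anti               = ⊤
up S c        ~ up S′ c′           = (∀ x → S x ≡ S′ x) × c ≡ c′
down S c      ~ down S′ c′         = (∀ x → S x ≡ S′ x) × c ≡ c′
two S a b c d ~ two S′ a′ b′ c′ d′ = (∀ x → S x ≡ S′ x) × (a , b , c , d) ≡ (a′ , b′ , c′ , d′)
_             ~ _                  = ⊥

-- A down-star needs three elements, and the lower ends of two chains are
-- listed in increasing order, so that no relation has two valid codes.
Valid : Code k → Set
Valid anti            = ⊤
Valid (up S c)        = T (S c) × ∃[ y ] T (S y) × c ≢ y
Valid (down S c)      = T (S c) × ∃[ y ] ∃[ y′ ] T (S y) × T (S y′) × c ≢ y × c ≢ y′ × y ≢ y′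
Valid (two S a b c d) = Unique (a ∷ b ∷ c ∷ d ∷ []) × toℕ a < toℕ c × size S ≡ 4 ×
  (∀ x → T (S x) → x ∈ (a ∷ b ∷ c ∷ d ∷ [])) × (∀ {x} → x ∈ (a ∷ b ∷ c ∷ d ∷ []) → T (S x))

upStar-poset : (S : Fin k → Bool) (c : Fin k) → IsPoset (upStar S c)
upStar-poset S c = record
  { reflexive  = λ x → upStar-intro {S = S} {c} {x} {x} (inj₁ refl)
  ; antisym    = λ {x} {y} p q → asym (upStar-elim {S = S} {c} {x} {y} p) (upStar-elim {S = S} {c} {y} {x} q)
  ; transitive = λ {x} {y} {z} p q → upStar-intro {S = S} {c} {x} {z}
      (tr (upStar-elim {S = S} {c} {x} {y} p) (upStar-elim {S = S} {c} {y} {z} q))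
  }
  where
  asym : ∀ {x y} → x ≡ y ⊎ (x ≡ c × T (S y)) → y ≡ x ⊎ (y ≡ c × T (S x)) → x ≡ y
  asym (inj₁ e)        _                = e
  asym (inj₂ _)        (inj₁ e)         = sym e
  asym (inj₂ (e , _))  (inj₂ (e′ , _))  = trans e (sym e′)
  tr : ∀ {x y z} → x ≡ y ⊎ (x ≡ c × T (S y)) → y ≡ z ⊎ (y ≡ c × T (S z)) → x ≡ z ⊎ (x ≡ c × T (S z))
  tr (inj₁ refl)    q               = q
  tr (inj₂ p)       (inj₁ refl)     = inj₂ p
  tr (inj₂ (e , _)) (inj₂ (_ , Sz)) = inj₂ (e , Sz)

twoChains-poset : {a b c d : Fin k} → Unique (a ∷ b ∷ c ∷ d ∷ []) → IsPoset (twoChains a b c d)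
twoChains-poset {k} {a} {b} {c} {d} ((ab ∷ ac ∷ ad ∷ []) ∷ (bc ∷ bd ∷ []) ∷ (cd ∷ []) ∷ [] ∷ []) = record
  { reflexive  = λ x → twoChains-intro {a = a} {b} {c} {d} {x} {x} (inj₁ refl)
  ; antisym    = λ p q → asym (elim p) (elim q)
  ; transitive = λ {x} {y} {z} p q → twoChains-intro {a = a} {b} {c} {d} {x} {z} (tr (elim p) (elim q))
  }
  where
  R : Fin k → Fin k → Set
  R x y = x ≡ y ⊎ (x ≡ a × y ≡ b) ⊎ (x ≡ c × y ≡ d)
  elim : ∀ {x y} → T (twoChains a b c d x y) → R x y
  elim {x} {y} = twoChains-elim {a = a} {b} {c} {d} {x} {y}
  asym : ∀ {x y} → R x y → R y x → x ≡ y
  asym (inj₁ e) _ = e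
  asym (inj₂ _) (inj₁ e) = sym e
  asym (inj₂ (inj₁ (refl , refl))) (inj₂ (inj₁ (e , _))) = sym e
  asym (inj₂ (inj₁ (refl , refl))) (inj₂ (inj₂ (e , _))) = ⊥-elim (bc e)
  asym (inj₂ (inj₂ (refl , refl))) (inj₂ (inj₁ (e , _))) = ⊥-elim (ad (sym e))
  asym (inj₂ (inj₂ (refl , refl))) (inj₂ (inj₂ (e , _))) = sym e
  tr : ∀ {x y z} → R x y → R y z → R x z
  tr (inj₁ refl) q = q
  tr p@(inj₂ _) (inj₁ refl) = p
  tr (inj₂ (inj₁ (_ , refl))) (inj₂ (inj₁ (e , _))) = ⊥-elim (ab (sym e))
  tr (inj₂ (inj₁ (_ , refl))) (inj₂ (inj₂ (e , _))) = ⊥-elim (bc e)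
  tr (inj₂ (inj₂ (_ , refl))) (inj₂ (inj₁ (e , _))) = ⊥-elim (ad (sym e))
  tr (inj₂ (inj₂ (_ , refl))) (inj₂ (inj₂ (e , _))) = ⊥-elim (cd (sym e))

antichain-poset : IsPoset (antichain {k})
antichain-poset = record
  { reflexive  = λ x → ≟ᶠ-intro {i = x} refl
  ; antisym    = λ {x} {y} p _ → ≟ᶠ-elim {i = x} {y} p
  ; transitive = λ {x} {y} {z} p q → ≟ᶠ-intro (trans (≟ᶠ-elim {i = x} {y} p) (≟ᶠ-elim {i = y} {z} q))
  }

rel-poset : (γ : Code k) → Valid γ → IsPoset (rel γ)
rel-poset anti            _        = antichain-poset
rel-poset (up S c)        _        = upStar-poset S c
rel-poset (down S c)      _        = flip-poset (upStar-poset S c)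
rel-poset (two S a b c d) (v! , _) = twoChains-poset v!

private
  module _ {S : Fin k → Bool} {c : Fin k} where
    spoke : ∀ {y} → T (S y) → T (upStar S c c y)
    spoke {y} Sy = upStar-intro {S = S} {c} {c} {y} (inj₂ (refl , Sy))

    centre : ∀ {x y} → T (upStar S c x y) → x ≢ y → x ≡ c
    centre {x} {y} h x≢y with upStar-elim {S = S} {c} {x} {y} h
    ... | inj₁ e       = ⊥-elim (x≢y e)
    ... | inj₂ (e , _) = e

  -- At the centre the relation holds by reflexivity and tells nothing about `S′`; membership of `c`
  -- in `S′` is supplied separately for that case.
  upStar-subset : ∀ {S S′ : Fin k → Bool} {c} → T (S′ c) → upStar S c ≈ upStar S′ c → ∀ {x} → T (S x) → T (S′ x)
  upStar-subset {S = S} {S′} {c} S′c eq {x} Sx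
    with upStar-elim {S = S′} {c} {c} {x} (subst T (eq c x) (spoke {S = S} {c} {x} Sx))
  ... | inj₁ refl      = S′c
  ... | inj₂ (_ , S′x) = S′x

  upStar-injective : ∀ {S S′ : Fin k → Bool} {c c′} → Valid (up S c) → T (S′ c′) →
    upStar S c ≈ upStar S′ c′ → (∀ x → S x ≡ S′ x) × c ≡ c′
  upStar-injective {S = S} {S′} {c} {c′} (Sc , y , Sy , c≢y) S′c′ eq
    with centre {S = S′} {c′} (subst T (eq c y) (spoke {S = S} {c} {y} Sy)) c≢y
  ... | refl = (λ x → T-ext (upStar-subset {S = S} {S′} S′c′ eq) (upStar-subset {S = S′} {S} Sc (≈-sym eq))) , refl

  first-chain : ∀ (a b c d : Fin k) → T (twoChains a b c d a b)
  first-chain a b c d = twoChains-intro {a = a} {b} {c} {d} {a} {b} (inj₂ (inj₁ (refl , refl)))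

  second-chain : ∀ (a b c d : Fin k) → T (twoChains a b c d c d)
  second-chain a b c d = twoChains-intro {a = a} {b} {c} {d} {c} {d} (inj₂ (inj₂ (refl , refl)))

  anti≉up : ∀ {S : Fin k → Bool} {c} → Valid (up S c) → ¬ antichain ≈ upStar S c
  anti≉up {S = S} {c} (_ , y , Sy , c≢y) eq = c≢y (≟ᶠ-elim (subst T (sym (eq c y)) (spoke {S = S} {c} {y} Sy)))

  down⇒up : ∀ {S : Fin k → Bool} {c} → Valid (down S c) → Valid (up S c)
  down⇒up (Sc , y , _ , Sy , _ , c≢y , _) = Sc , y , Sy , c≢y

  antichain-flip : antichain {k} ≈ flip antichain
  antichain-flip x y = T-ext (λ h → ≟ᶠ-intro (sym (≟ᶠ-elim {i = x} {y} h))) (λ h → ≟ᶠ-intro (sym (≟ᶠ-elim {i = y} {x} h)))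

  anti≉two : ∀ {S : Fin k → Bool} {a b c d} → Valid (two S a b c d) → ¬ antichain ≈ twoChains a b c d
  anti≉two {a = a} {b} {c} {d} (((ab ∷ _) ∷ _) , _) eq = ab (≟ᶠ-elim (subst T (sym (eq a b)) (first-chain a b c d)))

  -- All edges of an up-star start at one point, while a down-star on three or more elements has
  -- edges with different lower ends.
  up≉down : ∀ {S S′ : Fin k → Bool} {c c′} → Valid (down S′ c′) → ¬ upStar S c ≈ downStar S′ c′
  up≉down {S = S} {S′} {c} {c′} (_ , y , y′ , Sy , Sy′ , c≢y , c≢y′ , y≢y′) eq = y≢y′
    (trans (centre {S = S} {c} (subst T (sym (eq y c′)) (spoke {S = S′} {c′} {y} Sy)) (≢-sym c≢y))
      (sym (centre {S = S} {c} (subst T (sym (eq y′ c′)) (spoke {S = S′} {c′} {y′} Sy′)) (≢-sym c≢y′))))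

  -- The two chains have different lower ends, which rules out an up-star; for down-stars their
  -- different upper ends serve the same purpose.
  up≉two : ∀ {S S′ : Fin k → Bool} {o a b c d} → Valid (two S′ a b c d) → ¬ upStar S o ≈ twoChains a b c d
  up≉two {S = S} {o = o} {a} {b} {c} {d} (((ab ∷ ac ∷ _) ∷ _ ∷ (cd ∷ []) ∷ _) , _) eq = ac
    (trans (centre {S = S} {o} (subst T (sym (eq a b)) (first-chain a b c d)) ab)
      (sym (centre {S = S} {o} (subst T (sym (eq c d)) (second-chain a b c d)) cd)))

  down≉two : ∀ {S S′ : Fin k → Bool} {o a b c d} → Valid (two S′ a b c d) → ¬ downStar S o ≈ twoChains a b c d
  down≉two {S = S} {o = o} {a} {b} {c} {d} (((ab ∷ _) ∷ (_ ∷ bd ∷ _) ∷ (cd ∷ []) ∷ _) , _) eq = bd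
    (trans (centre {S = S} {o} (subst T (sym (eq a b)) (first-chain a b c d)) (≢-sym ab))
      (sym (centre {S = S} {o} (subst T (sym (eq c d)) (second-chain a b c d)) (≢-sym cd))))

  two-injective : ∀ {S S′ : Fin k → Bool} {a b c d a′ b′ c′ d′} →
    Valid (two S a b c d) → Valid (two S′ a′ b′ c′ d′) → twoChains a b c d ≈ twoChains a′ b′ c′ d′ →
    (∀ x → S x ≡ S′ x) × (a , b , c , d) ≡ (a′ , b′ , c′ , d′)
  two-injective {a = a} {b} {c} {d} {a′} {b′} {c′} {d′}
    (((ab ∷ ac ∷ _) ∷ _ ∷ (cd ∷ []) ∷ _) , a<c , _ , in₁ , out₁) (_ , a′<c′ , _ , in₂ , out₂) eq
    with twoChains-elim {a = a′} {b′} {c′} {d′} {a} {b} (subst T (eq a b) (first-chain a b c d))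
       | twoChains-elim {a = a′} {b′} {c′} {d′} {c} {d} (subst T (eq c d) (second-chain a b c d))
  ... | inj₁ e | _ = ⊥-elim (ab e)
  ... | inj₂ _ | inj₁ e = ⊥-elim (cd e)
  ... | inj₂ (inj₁ (refl , refl)) | inj₂ (inj₁ (e , _)) = ⊥-elim (ac (sym e))
  ... | inj₂ (inj₁ (refl , refl)) | inj₂ (inj₂ (refl , refl)) =
    (λ x → T-ext (out₂ ∘ in₁ x) (out₁ ∘ in₂ x)) , refl
  ... | inj₂ (inj₂ (refl , refl)) | inj₂ (inj₁ (refl , refl)) = ⊥-elim (<-asym a<c a′<c′)
  ... | inj₂ (inj₂ (refl , refl)) | inj₂ (inj₂ (e , _)) = ⊥-elim (ac (sym e))

rel-injective : (γ γ′ : Code k) → Valid γ → Valid γ′ → rel γ ≈ rel γ′ → γ ~ γ′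
rel-injective anti            anti                 v v′ eq = tt
rel-injective anti            (up S c)             v v′ eq = anti≉up v′ eq
rel-injective anti            (down S c)           v v′ eq = anti≉up (down⇒up v′) (≈-trans antichain-flip (λ x y → eq y x))
rel-injective anti            (two S a b c d)      v v′ eq = anti≉two {S = S} v′ eq
rel-injective (up S c)        anti                 v v′ eq = anti≉up v (≈-sym eq)
rel-injective (up S c)        (up S′ c′)           v v′ eq = upStar-injective v (proj₁ v′) eq
rel-injective (up S c)        (down S′ c′)         v v′ eq = up≉down {S = S} v′ eq
rel-injective (up S c)        (two S′ a′ b′ c′ d′) v v′ eq = up≉two {S = S} {S′} v′ eq
rel-injective (down S c)      anti                 v v′ eq = anti≉up (down⇒up v) (≈-trans antichain-flip (λ x y → sym (eq y x)))
rel-injective (down S c)      (up S′ c′)           v v′ eq = up≉down {S = S′} v (≈-sym eq)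
rel-injective (down S c)      (down S′ c′)         v v′ eq = upStar-injective (down⇒up v) (proj₁ v′) (λ x y → eq y x)
rel-injective (down S c)      (two S′ a′ b′ c′ d′) v v′ eq = down≉two {S = S} {S′} v′ eq
rel-injective (two S a b c d) anti                 v v′ eq = anti≉two {S = S} v (≈-sym eq)
rel-injective (two S a b c d) (up S′ c′)           v v′ eq = up≉two {S = S′} {S} v (≈-sym eq)
rel-injective (two S a b c d) (down S′ c′)         v v′ eq = down≉two {S = S′} {S} v (≈-sym eq)
rel-injective (two S a b c d) (two S′ a′ b′ c′ d′) v v′ eq = two-injective {S = S} {S′} v v′ eq

-- Pairs of chains on a four-element set

Quad : Set
Quad = Fin 4 × Fin 4 × Fin 4 × Fin 4

-- The 24 arrangements of four positions as p < q and r < s are halved by the order of the lower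
-- ends, which leaves 12 pairs of chains.
Good : Quad → Set
Good (p , q , r , s) = Unique (p ∷ q ∷ r ∷ s ∷ []) × toℕ p < toℕ r × (∀ i → i ∈ (p ∷ q ∷ r ∷ s ∷ []))

Good? : ∀ t → Dec (Good t)
Good? (p , q , r , s) = VAP.allPairs? (λ x y → ¬? (x F.≟ y)) (p ∷ q ∷ r ∷ s ∷ []) ×-dec
  ((toℕ p <? toℕ r) ×-dec F.all? (λ i → _∈?_ F._≟_ i (p ∷ q ∷ r ∷ s ∷ [])))

allQuads : List Quad
allQuads = cartesianProduct (allFin 4) (cartesianProduct (allFin 4) (cartesianProduct (allFin 4) (allFin 4)))

abstract
  -- Abstract, so that the search through the 256 quadruples of positions is evaluated only for
  -- `length-quads`; elsewhere the list is known by its properties.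
  quads : List Quad
  quads = filter Good? allQuads

  length-quads : length quads ≡ 12
  length-quads = refl

  quads-unique : AllPairs _≢_ quads
  quads-unique = UP.filter⁺ Good? (UP.cartesianProduct⁺ (UP.allFin⁺ 4) (UP.cartesianProduct⁺ (UP.allFin⁺ 4) (UP.cartesianProduct⁺ (UP.allFin⁺ 4) (UP.allFin⁺ 4))))

  quads-complete : ∀ {t} → Good t → t ∈ quads
  quads-complete {p , q , r , s} g = ∈-filter⁺ Good?
    (∈-cartesianProduct⁺ (∈-allFin p) (∈-cartesianProduct⁺ (∈-allFin q) (∈-cartesianProduct⁺ (∈-allFin r) (∈-allFin s)))) g

  quads-sound : ∀ {t} → t ∈ quads → Good t
  quads-sound t∈ = proj₂ (∈-filter⁻ Good? {xs = allQuads} t∈)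

lookup-mono : ∀ {n} {R : Fin k → Fin k → Set} {v : Vec (Fin k) n} → VAP.AllPairs R v →
  ∀ {i j} → toℕ i < toℕ j → R (lookup v i) (lookup v j)
lookup-mono (R# ∷ _)  {fzero}  {fsuc j} _        = lookup⁺ R# j
lookup-mono (_ ∷ Rv)  {fsuc i} {fsuc j} (s≤s lt) = lookup-mono Rv lt

module _ (S : Fin k → Bool) where

  twoAt : Vec (Fin k) 4 → Quad → Code k
  twoAt v (p , q , r , s) = two S (lookup v p) (lookup v q) (lookup v r) (lookup v s)

  twosOf : List (Fin k) → List (Code k)
  twosOf (a ∷ b ∷ c ∷ d ∷ []) = map (twoAt (a ∷ b ∷ c ∷ d ∷ [])) quads
  twosOf _                    = []

  ups downs twos : List (Code k)
  ups   = map (up S) (elems S)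
  downs = map (down S) (elems S)
  twos  = twosOf (elems S)

  -- The size is an argument of its own, later instantiated by `size S`, so that the clauses can
  -- compute.
  codesAt : ℕ → List (Code k)
  codesAt 0 = []
  codesAt 1 = []
  codesAt 2 = ups
  codesAt 3 = ups ++ downs
  codesAt 4 = ups ++ (downs ++ twos)
  codesAt (suc (suc (suc (suc (suc _))))) = ups ++ downs

  -- Membership in `codesAt` by type of code instead of by size: a star is allowed from a least size
  -- on, a pair of chains at size 4 alone.
  data In : ℕ → Code k → Set where
    in-up   : ∀ {n c} → 2 ≤ n → c ∈ elems S → In n (up S c)
    in-down : ∀ {n c} → 3 ≤ n → c ∈ elems S → In n (down S c)
    in-two  : ∀ {γ} → γ ∈ twos → In 4 γ

  private
    2≤ : ∀ {n} → 2 ≤ suc (suc n)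
    2≤ = s≤s (s≤s z≤n)
    3≤ : ∀ {n} → 3 ≤ suc (suc (suc n))
    3≤ = s≤s 2≤

    ups-elim : ∀ {n γ} → 2 ≤ n → γ ∈ ups → In n γ
    ups-elim le γ∈ with ∈-map⁻ (up S) γ∈
    ... | c , c∈ , refl = in-up le c∈

    downs-elim : ∀ {n γ} → 3 ≤ n → γ ∈ downs → In n γ
    downs-elim le γ∈ with ∈-map⁻ (down S) γ∈
    ... | c , c∈ , refl = in-down le c∈

    stars-elim : ∀ {n γ} → 3 ≤ n → γ ∈ ups ++ downs → In n γ
    stars-elim le γ∈ = [ ups-elim (≤-trans (n≤1+n 2) le) , downs-elim le ]′ (∈-++⁻ ups γ∈)

  codesAt-elim : ∀ n {γ} → γ ∈ codesAt n → In n γ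
  codesAt-elim 2 γ∈ = ups-elim ≤-refl γ∈
  codesAt-elim 3 γ∈ = stars-elim ≤-refl γ∈
  codesAt-elim 4 γ∈ = [ ups-elim 2≤ , (λ γ∈′ → [ downs-elim 3≤ , in-two ]′ (∈-++⁻ downs γ∈′)) ]′ (∈-++⁻ ups γ∈)
  codesAt-elim (suc (suc (suc (suc (suc _))))) γ∈ = stars-elim 3≤ γ∈

  codesAt-intro : ∀ n {γ} → In n γ → γ ∈ codesAt n
  codesAt-intro 1 (in-up (s≤s ()) _)
  codesAt-intro 2 (in-up _ c∈)   = ∈-map⁺ (up S) c∈
  codesAt-intro 3 (in-up _ c∈)   = ∈-++⁺ˡ (∈-map⁺ (up S) c∈)
  codesAt-intro 4 (in-up _ c∈)   = ∈-++⁺ˡ (∈-map⁺ (up S) c∈)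
  codesAt-intro (suc (suc (suc (suc (suc _))))) (in-up _ c∈) = ∈-++⁺ˡ (∈-map⁺ (up S) c∈)
  codesAt-intro 1 (in-down (s≤s ()) _)
  codesAt-intro 2 (in-down (s≤s (s≤s ())) _)
  codesAt-intro 3 (in-down _ c∈) = ∈-++⁺ʳ ups (∈-map⁺ (down S) c∈)
  codesAt-intro 4 (in-down _ c∈) = ∈-++⁺ʳ ups (∈-++⁺ˡ (∈-map⁺ (down S) c∈))
  codesAt-intro (suc (suc (suc (suc (suc _))))) (in-down _ c∈) = ∈-++⁺ʳ ups (∈-map⁺ (down S) c∈)
  codesAt-intro 4 (in-two γ∈)    = ∈-++⁺ʳ ups (∈-++⁺ʳ downs γ∈)

  private
    four : ∀ (L : List (Fin k)) → length L ≡ 4 → ∃[ a ] ∃[ b ] ∃[ c ] ∃[ d ] L ≡ a ∷ b ∷ c ∷ d ∷ []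
    four (a ∷ b ∷ c ∷ d ∷ []) refl = a , b , c , d , refl

  -- Once the elements of `S` are a sorted vector, positions in `Fin 4` stand for elements, and the
  -- order of positions is the order of elements. Thus one list `quads` serves every four-element
  -- set.
  record Quadruple : Set where
    field
      v        : Vec (Fin k) 4
      twos≡    : twos ≡ map (twoAt v) quads
      sorted   : VAP.AllPairs (λ x y → toℕ x < toℕ y) v
      v-sound  : ∀ i → T (S (lookup v i))
      position : ∀ {x} → T (S x) → ∃[ i ] lookup v i ≡ x

    unique : Unique v
    unique = VAP.map (λ lt eq → <-irrefl (cong toℕ eq) lt) sorted

    v-injective : ∀ {i j} → lookup v i ≡ lookup v j → i ≡ j
    v-injective = lookup-injective unique _ _

  quadruple : size S ≡ 4 → Quadruple
  quadruple s≡4 with elems S in eq | elems-sorted S | four (elems S) (trans (length-elems S) s≡4)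
  ... | _ | (ab ∷ ac ∷ ad ∷ []) ∷ (bc ∷ bd ∷ []) ∷ (cd ∷ []) ∷ [] ∷ [] | a , b , c , d , refl = record
    { v        = a ∷ b ∷ c ∷ d ∷ []
    ; twos≡    = cong twosOf eq
    ; sorted   = (ab ∷ ac ∷ ad ∷ []) ∷ (bc ∷ bd ∷ []) ∷ (cd ∷ []) ∷ [] ∷ []
    ; v-sound  = λ i → elems-sound {S = S} (subst (lookup (a ∷ b ∷ c ∷ d ∷ []) i ∈_) (sym eq) (hit i))
    ; position = λ Sx → pos (subst (_ ∈_) eq (elems-complete {S = S} Sx))
    }
    where
    hit : ∀ i → lookup (a ∷ b ∷ c ∷ d ∷ []) i ∈ (a ∷ b ∷ c ∷ d ∷ [])
    hit 0F = here refl
    hit 1F = there (here refl)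
    hit 2F = there (there (here refl))
    hit 3F = there (there (there (here refl)))
    pos : ∀ {x} → x ∈ (a ∷ b ∷ c ∷ d ∷ []) → ∃[ i ] lookup (a ∷ b ∷ c ∷ d ∷ []) i ≡ x
    pos (here refl)                         = 0F , refl
    pos (there (here refl))                 = 1F , refl
    pos (there (there (here refl)))         = 2F , refl
    pos (there (there (there (here refl)))) = 3F , refl

  twos-elim : size S ≡ 4 → ∀ {γ} → γ ∈ twos → ∃[ a ] ∃[ b ] ∃[ c ] ∃[ d ] γ ≡ two S a b c d × Valid γ
  twos-elim s≡4 γ∈ with quadruple s≡4
  ... | record { v = v ; twos≡ = twos≡ ; sorted = sorted ; v-sound = v-sound ; position = position }
      with ∈-map⁻ (twoAt v) (subst (_ ∈_) twos≡ γ∈)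
  ... | (p , q , r , s) , t∈ , refl with quads-sound t∈
  ... | t! , p<r , onto = _ , _ , _ , _ , refl ,
    VUP.map⁺ (lookup-injective (VAP.map (λ lt eq → <-irrefl (cong toℕ eq) lt) sorted) _ _) t! ,
    lookup-mono sorted p<r , s≡4 , covers , sound
    where
    covers : ∀ x → T (S x) → x ∈ (lookup v p ∷ lookup v q ∷ lookup v r ∷ lookup v s ∷ [])
    covers x Sx with position Sx
    ... | i , refl = ∈-map⁺ (lookup v) (onto i)
    sound : ∀ {x} → x ∈ (lookup v p ∷ lookup v q ∷ lookup v r ∷ lookup v s ∷ []) → T (S x)
    sound x∈ with ∈-map⁻ (lookup v) {xs = p ∷ q ∷ r ∷ s ∷ []} x∈
    ... | i , _ , refl = v-sound i

  In-valid : ∀ {γ} → In (size S) γ → Valid γ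
  In-valid = go refl
    where
    -- The index `size S` is generalised to a variable with an equation, since `in-two` can be
    -- matched only if the index may become 4.
    go : ∀ {n γ} → size S ≡ n → In n γ → Valid γ
    go s≡n (in-up 2≤n c∈) with another (elems-unique S) (subst (2 ≤_) (sym (trans (length-elems S) s≡n)) 2≤n) _
    ... | y , y∈ , c≢y = elems-sound {S = S} c∈ , y , elems-sound {S = S} y∈ , c≢y
    go s≡n (in-down 3≤n c∈) with twoOthers (elems-unique S) (subst (3 ≤_) (sym (trans (length-elems S) s≡n)) 3≤n) _
    ... | y , y′ , y∈ , y′∈ , ne = elems-sound {S = S} c∈ , y , y′ , elems-sound {S = S} y∈ , elems-sound {S = S} y′∈ , ne
    go s≡4 (in-two γ∈) = proj₂ (proj₂ (proj₂ (proj₂ (proj₂ (twos-elim s≡4 γ∈)))))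

  anti≁In : ∀ {γ} → In (size S) γ → ¬ anti ~ γ
  anti≁In i = go refl i
    where
    go : ∀ {n γ} → size S ≡ n → In n γ → ¬ anti ~ γ
    go _   (in-up _ _)   ()
    go _   (in-down _ _) ()
    go s≡4 (in-two γ∈) eq with twos-elim s≡4 γ∈
    ... | _ , _ , _ , _ , refl , _ = eq

-- The list of all codes and its length

support : Code k → (Fin k → Bool)
support anti            = const false
support (up S _)        = S
support (down S _)      = S
support (two S _ _ _ _) = S

~-support : (γ γ′ : Code k) → γ ~ γ′ → ∀ x → support γ x ≡ support γ′ x
~-support anti            anti            _        x = refl
~-support (up _ _)        (up _ _)        (eq , _) = eq
~-support (down _ _)      (down _ _)      (eq , _) = eq
~-support (two _ _ _ _ _) (two _ _ _ _ _) (eq , _) = eq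

In-support : (S : Fin k → Bool) → ∀ {γ} → In S (size S) γ → support γ ≡ S
In-support S = go refl
  where
  go : ∀ {n γ} → size S ≡ n → In S n γ → support γ ≡ S
  go _   (in-up _ _)   = refl
  go _   (in-down _ _) = refl
  go s≡4 (in-two γ∈) with twos-elim S s≡4 γ∈
  ... | _ , _ , _ , _ , refl , _ = refl

-- The last clause of `z` gives 2 at 1, but a star on a single point is the antichain, which has its
-- own code. Sizes 0 and 1 therefore count as 0.
multiplicity : ℕ → ℕ
multiplicity 0 = 0
multiplicity 1 = 0
multiplicity n = z n

module _ (S : Fin k → Bool) where

  private
    Distinct : Code k → Code k → Set
    Distinct γ γ′ = ¬ γ ~ γ′

    ups! : AllPairs Distinct (ups S)
    ups! = APP.map⁺ (AP.map (λ c≢c′ → c≢c′ ∘ proj₂) (elems-unique S))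

    downs! : AllPairs Distinct (downs S)
    downs! = APP.map⁺ (AP.map (λ c≢c′ → c≢c′ ∘ proj₂) (elems-unique S))

    stars! : AllPairs Distinct (ups S ++ downs S)
    stars! = APP.++⁺ ups! downs! (All.tabulate λ x∈ → All.tabulate λ y∈ → apart (∈-map⁻ (up S) x∈) (∈-map⁻ (down S) y∈))
      where
      apart : ∀ {γ γ′} → ∃[ c ] c ∈ elems S × γ ≡ up S c → ∃[ c ] c ∈ elems S × γ′ ≡ down S c → Distinct γ γ′
      apart (_ , _ , refl) (_ , _ , refl) ()

    twos! : size S ≡ 4 → AllPairs Distinct (twos S)
    twos! s≡4 = subst (AllPairs Distinct) (sym twos≡) (APP.map⁺ {f = twoAt S v} (AP.map distinct quads-unique))
      where
      open Quadruple (quadruple S s≡4)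
      distinct : ∀ {t t′} → t ≢ t′ → Distinct (twoAt S v t) (twoAt S v t′)
      distinct t≢t′ (_ , eq) with ,-injective eq
      ... | e₁ , eq₂ with ,-injective eq₂
      ... | e₂ , eq₃ with ,-injective eq₃
      ... | e₃ , e₄ = t≢t′ (cong₂ _,_ (v-injective e₁) (cong₂ _,_ (v-injective e₂) (cong₂ _,_ (v-injective e₃) (v-injective e₄))))

    downs-twos! : size S ≡ 4 → AllPairs Distinct (downs S ++ twos S)
    downs-twos! s≡4 = APP.++⁺ downs! (twos! s≡4)
      (All.tabulate λ x∈ → All.tabulate λ y∈ → apart (∈-map⁻ (down S) x∈) (twos-elim S s≡4 y∈))
      where
      apart : ∀ {γ γ′} → ∃[ c ] c ∈ elems S × γ ≡ down S c → ∃[ a ] ∃[ b ] ∃[ c ] ∃[ d ] γ′ ≡ two S a b c d × Valid γ′ → Distinct γ γ′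
      apart (_ , _ , refl) (_ , _ , _ , _ , refl , _) ()

    all! : size S ≡ 4 → AllPairs Distinct (ups S ++ (downs S ++ twos S))
    all! s≡4 = APP.++⁺ ups! (downs-twos! s≡4)
      (All.tabulate λ x∈ → All.tabulate λ y∈ → apart (∈-map⁻ (up S) x∈) (∈-++⁻ (downs S) y∈))
      where
      apart : ∀ {γ γ′} → ∃[ c ] c ∈ elems S × γ ≡ up S c → γ′ ∈ downs S ⊎ γ′ ∈ twos S → Distinct γ γ′
      apart (_ , _ , refl) (inj₁ γ′∈) eq with ∈-map⁻ (down S) γ′∈
      ... | _ , _ , refl = eq
      apart (_ , _ , refl) (inj₂ γ′∈) eq with twos-elim S s≡4 γ′∈
      ... | _ , _ , _ , _ , refl , _ = eq

  codesAt-unique : AllPairs (λ γ γ′ → ¬ γ ~ γ′) (codesAt S (size S))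
  codesAt-unique = go (size S) refl
    where
    go : ∀ n → size S ≡ n → AllPairs Distinct (codesAt S n)
    go 0 _ = []
    go 1 _ = []
    go 2 _ = ups!
    go 3 _ = stars!
    go 4 s≡4 = all! s≡4
    go (suc (suc (suc (suc (suc _))))) _ = stars!

  -- The origin of the numbers `z`: 2 up-stars at size 2, 3 + 3 stars at size 3, 4 + 4 stars and 12
  -- pairs of chains at size 4, and only the stars of both directions beyond.
  length-codesAt : length (codesAt S (size S)) ≡ multiplicity (size S)
  length-codesAt = go (size S) refl
    where
    open ≡-Reasoning
    ups-length : ∀ {n} → size S ≡ n → length (ups S) ≡ n
    ups-length s≡n = trans (length-map (up S) (elems S)) (trans (length-elems S) s≡n)
    downs-length : ∀ {n} → size S ≡ n → length (downs S) ≡ n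
    downs-length s≡n = trans (length-map (down S) (elems S)) (trans (length-elems S) s≡n)
    twos-length : size S ≡ 4 → length (twos S) ≡ 12
    twos-length s≡4 = trans (cong length (Quadruple.twos≡ (quadruple S s≡4)))
      (trans (length-map (twoAt S (Quadruple.v (quadruple S s≡4))) quads) length-quads)
    stars-length : ∀ {n} → size S ≡ n → length (ups S ++ downs S) ≡ 2 * n
    stars-length {n} s≡n = trans (length-++ (ups S))
      (cong₂ _+_ (ups-length s≡n) (trans (downs-length s≡n) (sym (+-identityʳ n))))
    go : ∀ n → size S ≡ n → length (codesAt S n) ≡ multiplicity n
    go 0 _ = refl
    go 1 _ = refl
    go 2 s≡n = ups-length s≡n
    go 3 s≡n = stars-length s≡n
    go 4 s≡n = trans (length-++ (ups S)) (cong₂ _+_ (ups-length s≡n)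
      (trans (length-++ (downs S)) (cong₂ _+_ (downs-length s≡n) (twos-length s≡n))))
    go (suc (suc (suc (suc (suc n))))) s≡n = stars-length s≡n

codes : ∀ k → List (Code k)
codes k = anti ∷ concatMap (λ S → codesAt S (size S)) (subsets k)

-- Codes from different blocks are told apart by their supports, as equivalent codes have pointwise
-- equal supports.
codes-unique : ∀ k → AllPairs (λ γ γ′ → ¬ γ ~ γ′) (codes k)
codes-unique k = All.tabulate anti# ∷ concatMap-AllPairs _ (subsets k) (λ {S} _ → codesAt-unique S) (subsets-unique k)
  (λ {S} {S′} S#S′ {γ} {γ′} γ∈ γ′∈ γ~γ′ → S#S′ λ x → begin
    S x           ≡⟨ cong (λ S → S x) (In-support S (codesAt-elim S (size S) γ∈)) ⟨
    support γ x   ≡⟨ ~-support γ γ′ γ~γ′ x ⟩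
    support γ′ x  ≡⟨ cong (λ S → S x) (In-support S′ (codesAt-elim S′ (size S′) γ′∈)) ⟩
    S′ x          ∎)
  where
  open ≡-Reasoning
  anti# : ∀ {γ} → γ ∈ concatMap (λ S → codesAt S (size S)) (subsets k) → ¬ anti ~ γ
  anti# γ∈ with ∈-concatMap-elim (subsets k) γ∈
  ... | S , _ , γ∈′ = anti≁In S (codesAt-elim S (size S) γ∈′)

codes-valid : ∀ {γ : Code k} → γ ∈ codes k → Valid γ
codes-valid (here refl) = tt
codes-valid {k} (there γ∈) with ∈-concatMap-elim (subsets k) γ∈
... | S , _ , γ∈′ = In-valid S (codesAt-elim S (size S) γ∈′)

codes-intro : ∀ {S : Fin k → Bool} {γ} → S ∈ subsets k → In S (size S) γ → γ ∈ codes k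
codes-intro {S = S} S∈ i = there (∈-concatMap-intro S∈ (codesAt-intro S (size S) i))

upStar-cong : {S S′ : Fin k → Bool} {c : Fin k} → (∀ x → S x ≡ S′ x) → upStar S c ≈ upStar S′ c
upStar-cong {c = c} eq x y = cong (λ b → (x ≟ᶠ y) ∨ ((x ≟ᶠ c) ∧ b)) (eq y)

module _ {S : Fin k → Bool} (S∈ : S ∈ subsets k) (size≡4 : size S ≡ 4) (quad : Quadruple S) where
  open Quadruple quad

  private
    at : Quad → List (Fin k)
    at (p , q , r , s) = lookup v p ∷ lookup v q ∷ lookup v r ∷ lookup v s ∷ []

  twoAt∈codes : ∀ {p q r s} → Unique (lookup v p ∷ lookup v q ∷ lookup v r ∷ lookup v s ∷ []) →
    toℕ (lookup v p) < toℕ (lookup v r) → (∀ {x} → T (S x) → x ∈ at (p , q , r , s)) →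
    twoAt S v (p , q , r , s) ∈ codes k
  twoAt∈codes {p} {q} {r} {s} ((ab ∷ ac ∷ ad ∷ []) ∷ (bc ∷ bd ∷ []) ∷ (cd ∷ []) ∷ [] ∷ []) a<c from =
    codes-intro S∈ (subst (λ n → In S n (twoAt S v (p , q , r , s))) (sym size≡4)
      (in-two (subst (twoAt S v (p , q , r , s) ∈_) (sym twos≡) (∈-map⁺ (twoAt S v) (quads-complete good)))))
    where
    sep : ∀ {i j} → lookup v i ≢ lookup v j → i ≢ j
    sep ne refl = ne refl
    -- Looking up in the sorted vector is strictly increasing, so the opposite order of positions
    -- would contradict the order of the lower ends.
    p<r : toℕ p < toℕ r
    p<r with <-cmp (toℕ p) (toℕ r)
    ... | tri< lt _ _ = lt
    ... | tri≈ _ eq _ = ⊥-elim (sep ac (F.toℕ-injective eq))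
    ... | tri> _ _ gt = ⊥-elim (<-asym a<c (lookup-mono sorted gt))
    onto : ∀ i → i ∈ (p ∷ q ∷ r ∷ s ∷ [])
    onto i with ∈-map⁻ (lookup v) {xs = p ∷ q ∷ r ∷ s ∷ []} (from (v-sound i))
    ... | j , j∈ , eq = subst (_∈ (p ∷ q ∷ r ∷ s ∷ [])) (sym (v-injective eq)) j∈
    good : Good (p , q , r , s)
    good = ((sep ab ∷ sep ac ∷ sep ad ∷ []) ∷ (sep bc ∷ sep bd ∷ []) ∷ (sep cd ∷ []) ∷ [] ∷ []) , p<r , onto

  two∈codes : {a b c d : Fin k} → Unique (a ∷ b ∷ c ∷ d ∷ []) → toℕ a < toℕ c →
    (∀ {x} → x ∈ (a ∷ b ∷ c ∷ d ∷ []) → T (S x)) → (∀ {x} → T (S x) → x ∈ (a ∷ b ∷ c ∷ d ∷ [])) →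
    two S a b c d ∈ codes k
  two∈codes abcd! a<c to from
    with position (to (here refl)) | position (to (there (here refl)))
       | position (to (there (there (here refl)))) | position (to (there (there (there (here refl)))))
  ... | p , refl | q , refl | r , refl | s , refl = twoAt∈codes abcd! a<c from

-- Codes for all posets with many up-sets

HasCode : Rel k → Set
HasCode {k} Q = ∃[ γ ] γ ∈ codes k × Q ≈ rel γ

HasCode-resp-≈ : {Q Q′ : Rel k} → Q ≈ Q′ → HasCode Q′ → HasCode Q
HasCode-resp-≈ eq (γ , γ∈ , eqγ) = γ , γ∈ , ≈-trans eq eqγ

-- The support is the set of the four points, replaced by its pointwise equal representative in
-- `subsets k`. Its size is 4 because two lists without repetitions, its elements and the four
-- points, contain each other.
two-code : {a b c d : Fin k} → Unique (a ∷ b ∷ c ∷ d ∷ []) → toℕ a < toℕ c →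
  HasCode (twoChains a b c d)
two-code {k} {a} {b} {c} {d} v!@((ab ∷ ac ∷ ad ∷ []) ∷ (bc ∷ bd ∷ []) ∷ (cd ∷ []) ∷ [] ∷ []) a<c =
  code (subsets-complete (λ x → ⌊ _∈?_ F._≟_ x abcd ⌋))
  where
  abcd : List (Fin k)
  abcd = a ∷ b ∷ c ∷ d ∷ []
  code : ∃[ S ] S ∈ subsets k × (∀ x → ⌊ _∈?_ F._≟_ x abcd ⌋ ≡ S x) → HasCode (twoChains a b c d)
  code (S , S∈ , eqS) = two S a b c d , two∈codes S∈ size≡4 (quadruple S size≡4) v! a<c to from , λ _ _ → refl
    where
    to : ∀ {x} → x ∈ abcd → T (S x)
    to {x} x∈ = subst T (eqS x) (fromWitness x∈)
    from : ∀ {x} → T (S x) → x ∈ abcd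
    from {x} Sx = toWitness {a? = _∈?_ F._≟_ x abcd} (subst T (sym (eqS x)) Sx)
    size≡4 : size S ≡ 4
    size≡4 = trans (sym (length-elems S)) (≤-antisym
      (unique-length-≤ {ys = abcd} (elems-unique S) (λ x∈ → from (elems-sound {S = S} x∈)))
      (unique-length-≤ {xs = abcd} ((ab ∷ ac ∷ ad ∷ []) ∷ (bc ∷ bd ∷ []) ∷ (cd ∷ []) ∷ [] ∷ []) (λ x∈ → elems-complete {S = S} (to x∈))))

twoChains-swap : (a b c d : Fin k) → twoChains a b c d ≈ twoChains c d a b
twoChains-swap a b c d x y = cong ((x ≟ᶠ y) ∨_) (∨-comm ((x ≟ᶠ a) ∧ (y ≟ᶠ b)) _)

upStar-code : {S : Fin k → Bool} {c y : Fin k} → T (S c) → T (S y) → c ≢ y → HasCode (upStar S c)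
upStar-code {k} {S} {c} {y} Sc Sy c≢y = code (subsets-complete S)
  where
  code : ∃[ S′ ] S′ ∈ subsets k × (∀ x → S x ≡ S′ x) → HasCode (upStar S c)
  code (S′ , S′∈ , eqS) = up S′ c , codes-intro S′∈ (in-up 2≤ (∈S′ Sc)) , upStar-cong eqS
    where
    ∈S′ : ∀ {x} → T (S x) → x ∈ elems S′
    ∈S′ {x} Sx = elems-complete {S = S′} (subst T (eqS x) Sx)
    2≤ : 2 ≤ size S′
    2≤ = subst (2 ≤_) (length-elems S′) (unique-length-≤ {xs = c ∷ y ∷ []} ((c≢y ∷ []) ∷ [] ∷ [])
      λ { (here refl) → ∈S′ Sc ; (there (here refl)) → ∈S′ Sy })

downStar-code : {S : Fin k → Bool} {c y y′ : Fin k} → T (S c) → T (S y) → T (S y′) →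
  c ≢ y → c ≢ y′ → y ≢ y′ → HasCode (downStar S c)
downStar-code {k} {S} {c} {y} {y′} Sc Sy Sy′ c≢y c≢y′ y≢y′ = code (subsets-complete S)
  where
  code : ∃[ S′ ] S′ ∈ subsets k × (∀ x → S x ≡ S′ x) → HasCode (downStar S c)
  code (S′ , S′∈ , eqS) = down S′ c , codes-intro S′∈ (in-down 3≤ (∈S′ Sc)) , λ x y → upStar-cong eqS y x
    where
    ∈S′ : ∀ {x} → T (S x) → x ∈ elems S′
    ∈S′ {x} Sx = elems-complete {S = S′} (subst T (eqS x) Sx)
    3≤ : 3 ≤ size S′
    3≤ = subst (3 ≤_) (length-elems S′) (unique-length-≤ {xs = c ∷ y ∷ y′ ∷ []} ((c≢y ∷ c≢y′ ∷ []) ∷ (y≢y′ ∷ []) ∷ [] ∷ [])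
      λ { (here refl) → ∈S′ Sc ; (there (here refl)) → ∈S′ Sy ; (there (there (here refl))) → ∈S′ Sy′ })

twoChains-code : {a b c d : Fin k} → Unique (a ∷ b ∷ c ∷ d ∷ []) → HasCode (twoChains a b c d)
twoChains-code {a = a} {b} {c} {d} v!@((ab ∷ ac ∷ ad ∷ []) ∷ (bc ∷ bd ∷ []) ∷ (cd ∷ []) ∷ [] ∷ []) with <-cmp (toℕ a) (toℕ c)
... | tri≈ _ e _  = ⊥-elim (ac (F.toℕ-injective e))
... | tri< lt _ _ = two-code v! lt
... | tri> _ _ gt = HasCode-resp-≈ (twoChains-swap a b c d)
  (two-code ((cd ∷ ≢-sym ac ∷ ≢-sym bc ∷ []) ∷ (≢-sym ad ∷ ≢-sym bd ∷ []) ∷ (ab ∷ []) ∷ [] ∷ []) gt)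

few-or-code : {Q : Rel k} → IsPoset Q → Few Q ⊎ HasCode Q
few-or-code {k} {Q} P = go (shape P)
  where
  go : Shape Q → Few Q ⊎ HasCode Q
  go (few f)   = inj₁ f
  go (anti eq) = inj₂ (anti , here refl , eq)
  go (up S c y Sc Sy c≢y eq) = inj₂ (HasCode-resp-≈ eq (upStar-code {S = S} Sc Sy c≢y))
  go (down S c y y′ Sc Sy Sy′ c≢y c≢y′ y≢y′ eq) = inj₂ (HasCode-resp-≈ eq (downStar-code {S = S} Sc Sy Sy′ c≢y c≢y′ y≢y′))
  go (two a b c d v! eq) = inj₂ (HasCode-resp-≈ eq (twoChains-code v!))

-- Values of the up-set counts

starValue : ℕ → ℕ → ℕ
starValue k i = 2 ^ (k ∸ 1) + 2 ^ (k ∸ i)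

-- Passes from the multiplied count of `upsetCount-upStar` to the exponents of the main term; the
-- bounds on `k` and `s` make the truncated subtractions exact.
starValue-unique : ∀ {k s u} → 1 ≤ k → s ≤ k → 2 ^ s * (2 * u) ≡ 2 ^ s * 2 ^ k + 2 * 2 ^ k → u ≡ starValue k s
starValue-unique {suc k} {s} {u} _ s≤k eq = *-cancelˡ-≡ u (starValue (suc k) s) 2
  (*-cancelˡ-≡ (2 * u) (2 * starValue (suc k) s) (2 ^ s) {{m^n≢0 2 s}} (begin
    2 ^ s * (2 * u)                                      ≡⟨ eq ⟩
    2 ^ s * 2 ^ suc k + 2 * 2 ^ suc k                    ≡⟨ cong (λ x → 2 ^ s * 2 ^ suc k + 2 * x) split-power ⟨
    2 ^ s * (2 * 2 ^ k) + 2 * (2 ^ s * 2 ^ (suc k ∸ s))  ≡⟨ shuffle (2 ^ s) (2 ^ k) (2 ^ (suc k ∸ s)) ⟩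
    2 ^ s * (2 * (2 ^ k + 2 ^ (suc k ∸ s)))              ∎))
  where
  open ≡-Reasoning
  split-power : 2 ^ s * 2 ^ (suc k ∸ s) ≡ 2 ^ suc k
  split-power = trans (sym (^-distribˡ-+-* 2 s (suc k ∸ s))) (cong (2 ^_) (m+[n∸m]≡n s≤k))
  shuffle : ∀ a b c → a * (2 * b) + 2 * (a * c) ≡ a * (2 * (b + c))
  shuffle = solve-∀

-- The coincidence 9/16 = 1/2 + 1/16: two chains have as many up-sets as a star on four elements,
-- which is why they are absorbed into `z 4`.
twoChainsValue : ∀ {k u} → 4 ≤ k → 16 * u ≡ 2 ^ k * 9 → u ≡ starValue k 4
twoChainsValue {suc (suc (suc (suc k)))} {u} (s≤s (s≤s (s≤s (s≤s _)))) eq =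
  *-cancelˡ-≡ u (starValue (4 + k) 4) 16 (trans eq (expand (2 ^ k)))
  where
  expand : ∀ x → 2 * (2 * (2 * (2 * x))) * 9 ≡ 16 * (2 * (2 * (2 * x)) + x)
  expand = solve-∀

upsetCount-up : {S : Fin k → Bool} {c : Fin k} → T (S c) → upsetCount (upStar S c) ≡ starValue k (size S)
upsetCount-up {suc k} {S} {c} Sc = starValue-unique (s≤s z≤n) (size≤ S) (upsetCount-upStar S Sc)

upsetCount-rel : ∀ {γ : Code k} → Valid γ → γ ≢ anti → upsetCount (rel γ) ≡ starValue k (size (support γ))
upsetCount-rel {γ = anti}          _         ne = ⊥-elim (ne refl)
upsetCount-rel {γ = up S c}        (Sc , _)  _  = upsetCount-up {S = S} Sc
upsetCount-rel {γ = down S c}      (Sc , _)  _  = trans (upsetCount-flip (upStar S c)) (upsetCount-up {S = S} Sc)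
upsetCount-rel {k} {γ = two S a b c d} (v! , _ , s≡4 , _) _ rewrite s≡4 =
  twoChainsValue (subst (_≤ k) s≡4 (size≤ S)) (upsetCount-twoChains v!)

-- Binomial form of the sum over codes

∑< : ℕ → (ℕ → ℕ) → ℕ
∑< zero    f = 0
∑< (suc n) f = f 0 + ∑< n (f ∘ suc)

∑<-cong : ∀ n {f g : ℕ → ℕ} → (∀ i → f i ≡ g i) → ∑< n f ≡ ∑< n g
∑<-cong zero    h = refl
∑<-cong (suc n) h = cong₂ _+_ (h 0) (∑<-cong n (h ∘ suc))

∑<-mono : ∀ n {f g : ℕ → ℕ} → (∀ i → f i ≤ g i) → ∑< n f ≤ ∑< n g
∑<-mono zero    h = z≤n
∑<-mono (suc n) h = +-mono-≤ (h 0) (∑<-mono n (h ∘ suc))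

∑<-+ : ∀ n (f g : ℕ → ℕ) → ∑< n (λ i → f i + g i) ≡ ∑< n f + ∑< n g
∑<-+ zero    f g = refl
∑<-+ (suc n) f g rewrite ∑<-+ n (f ∘ suc) (g ∘ suc) = interchange (f 0) (g 0) (∑< n (f ∘ suc)) (∑< n (g ∘ suc))
  where
  interchange : ∀ a b c d → a + b + (c + d) ≡ a + c + (b + d)
  interchange = solve-∀

∑<-last : ∀ n (f : ℕ → ℕ) → ∑< (suc n) f ≡ ∑< n f + f n
∑<-last zero    f = +-identityʳ (f 0)
∑<-last (suc n) f = trans (cong (f 0 +_) (∑<-last n (f ∘ suc))) (sym (+-assoc (f 0) _ _))

∑<-*ʳ : ∀ n (f : ℕ → ℕ) c → ∑< n f * c ≡ ∑< n (λ i → f i * c)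
∑<-*ʳ zero    f c = refl
∑<-*ʳ (suc n) f c = trans (*-distribʳ-+ c (f 0) _) (cong (f 0 * c +_) (∑<-*ʳ n (f ∘ suc) c))

-- Induction by Pascal's rule: subsets with and without the first element contribute the two
-- binomial coefficients.
∑₂-size : ∀ k (g : ℕ → ℕ) → ∑₂ k (g ∘ size) ≡ ∑< (suc k) (λ i → (k choose i) * g i)
∑₂-size zero    g = sym (trans (+-identityʳ (1 * g 0)) (+-identityʳ (g 0)))
∑₂-size (suc k) g = begin
  ∑₂ k (g ∘ suc ∘ size) + ∑₂ k (g ∘ size)
    ≡⟨ cong₂ _+_ (∑₂-size k (g ∘ suc)) (∑₂-size k g) ⟩
  ∑< (suc k) (λ i → (k choose i) * g (suc i)) + ∑< (suc k) (λ i → (k choose i) * g i)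
    ≡⟨ cong (∑< (suc k) (λ i → (k choose i) * g (suc i)) +_) (sym append-zero) ⟩
  ∑< (suc k) (λ i → (k choose i) * g (suc i)) + (1 * g 0 + ∑< (suc k) (λ i → (k choose suc i) * g (suc i)))
    ≡⟨ swap (∑< (suc k) (λ i → (k choose i) * g (suc i))) (1 * g 0) _ ⟩
  1 * g 0 + (∑< (suc k) (λ i → (k choose i) * g (suc i)) + ∑< (suc k) (λ i → (k choose suc i) * g (suc i)))
    ≡⟨ cong (1 * g 0 +_) (sym (∑<-+ (suc k) (λ i → (k choose i) * g (suc i)) (λ i → (k choose suc i) * g (suc i)))) ⟩
  1 * g 0 + ∑< (suc k) (λ i → (k choose i) * g (suc i) + (k choose suc i) * g (suc i))
    ≡⟨ cong (1 * g 0 +_) (∑<-cong (suc k) λ i → trans (sym (*-distribʳ-+ (g (suc i)) (k choose i) (k choose suc i)))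
         (cong (_* g (suc i)) (nCk+nC[k+1]≡[n+1]C[k+1] k i))) ⟩
  1 * g 0 + ∑< (suc k) (λ i → (suc k choose suc i) * g (suc i))
    ∎
  where
  open ≡-Reasoning
  -- The sum is extended by a term with `k choose suc k`, which is 0, so that after its first term
  -- is split off it has the same range as the other sum.
  append-zero : ∑< (suc (suc k)) (λ i → (k choose i) * g i) ≡ ∑< (suc k) (λ i → (k choose i) * g i)
  append-zero = trans (∑<-last (suc k) (λ i → (k choose i) * g i))
    (trans (cong (λ c → ∑< (suc k) (λ i → (k choose i) * g i) + c * g (suc k)) (k>n⇒nCk≡0 (n<1+n k))) (+-identityʳ _))
  swap : ∀ a b c → a + (b + c) ≡ b + (a + c)
  swap = solve-∀

-- The local function of sumFromTo cannot be named from outside; it is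
-- recovered by unification from the second unfolding step.
mutual
  sumFromTo-go : ℕ → ℕ → (ℕ → ℕ) → ℕ → ℕ → ℕ
  sumFromTo-go = _

  sumFromTo-step : ∀ a b f t → suc b ∸ a ≡ suc t → sumFromTo a b f ≡ f a + sumFromTo-go a b f (suc a) t
  sumFromTo-step a b f t eq rewrite eq with suc a
  ... | i = refl

sumFromTo≡∑< : ∀ a b f → sumFromTo a b f ≡ ∑< (suc b ∸ a) (λ j → f (a + j))
sumFromTo≡∑< a b f = go a (suc b ∸ a)
  where
  go : ∀ i t → sumFromTo-go a b f i t ≡ ∑< t (λ j → f (i + j))
  go i zero    = refl
  go i (suc t) = cong₂ _+_ (cong f (sym (+-identityʳ i)))
    (trans (go (suc i) t) (∑<-cong t λ j → cong f (sym (+-suc i j))))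

correction : ℕ → ℕ → ℕ
correction k m = sumFromTo 2 k (λ i → z i * (k choose i) * starValue k i ^ m)

-- All codes with support `S` have the same up-set count, which depends on `size S` alone. The sum
-- can therefore be grouped first by `S` and then by size.
sumOver-codesAt : ∀ k m → sumOver (concatMap (λ S → codesAt S (size S)) (subsets k)) (λ γ → upsetCount (rel γ) ^ m)
  ≡ correction k m
sumOver-codesAt k m = begin
  sumOver (concatMap (λ S → codesAt S (size S)) (subsets k)) w  ≡⟨ sumOver-concatMap w _ (subsets k) ⟩
  sumOver (subsets k) (λ S → sumOver (codesAt S (size S)) w)    ≡⟨ sumOver-cong (subsets k) (λ {S} _ → at S) ⟩
  sumOver (subsets k) (g ∘ size)                                ≡⟨ sumOver-subsets k (λ eq → cong g (size-cong eq)) ⟩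
  ∑₂ k (g ∘ size)                                               ≡⟨ ∑₂-size k g ⟩
  ∑< (suc k) (λ i → (k choose i) * g i)                              ≡⟨ drop-two k ⟩
  ∑< (suc k ∸ 2) (λ j → z (2 + j) * (k choose (2 + j)) * starValue k (2 + j) ^ m)
                                                                ≡⟨ sumFromTo≡∑< 2 k _ ⟨
  correction k m                                                ∎
  where
  open ≡-Reasoning
  w : Code k → ℕ
  w γ = upsetCount (rel γ) ^ m
  g : ℕ → ℕ
  g i = multiplicity i * starValue k i ^ m
  at : ∀ S → sumOver (codesAt S (size S)) w ≡ g (size S)
  at S = trans (sumOver-cong (codesAt S (size S)) (λ {γ} γ∈ → let i = codesAt-elim S (size S) γ∈ in
      cong (_^ m) (trans (upsetCount-rel (In-valid S i) (λ { refl → anti≁In S i tt })) (cong (starValue k ∘ size) (In-support S i)))))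
    (trans (sumOver-const _ (codesAt S (size S))) (cong (_* starValue k (size S) ^ m) (length-codesAt S)))
  shuffle : ∀ c z v → c * (z * v) ≡ z * c * v
  shuffle = solve-∀
  -- The length of the range is separated from the `k` in the binomials, so that it can be split.
  -- The terms 0 and 1 vanish by `multiplicity`; for length 1 only the term 0 is there.
  drop-two : ∀ n → ∑< (suc n) (λ i → (k choose i) * g i) ≡ ∑< (suc n ∸ 2) (λ j → z (2 + j) * (k choose (2 + j)) * starValue k (2 + j) ^ m)
  drop-two zero    = trans (+-identityʳ _) (*-zeroʳ (k choose 0))
  drop-two (suc n) = cong₂ _+_ (*-zeroʳ (k choose 0)) (cong₂ _+_ (*-zeroʳ (k choose 1))
    (∑<-cong n λ j → shuffle (k choose (2 + j)) (z (2 + j)) (starValue k (2 + j) ^ m)))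

sumOver-codes : ∀ k m → sumOver (codes k) (λ γ → upsetCount (rel γ) ^ m) ≡ mainTerm k m
sumOver-codes k m = cong₂ _+_ (trans (cong (_^ m) (upsetCount-antichain k)) (^-*-assoc 2 k m)) (sumOver-codesAt k m)

-- Sums over posets against the main term

half : ℕ → ℕ
half k = ⌊ 2 ^ k /2⌋

2*half≤ : ∀ k → 2 * half k ≤ 2 ^ k
2*half≤ k = begin
  half k + (half k + 0)          ≡⟨ cong (half k +_) (+-identityʳ (half k)) ⟩
  half k + half k                ≤⟨ +-monoʳ-≤ (half k) (⌊n/2⌋≤⌈n/2⌉ (2 ^ k)) ⟩
  ⌊ 2 ^ k /2⌋ + ⌈ 2 ^ k /2⌉      ≡⟨ ⌊n/2⌋+⌈n/2⌉≡n (2 ^ k) ⟩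
  2 ^ k                          ∎
  where open ≤-Reasoning

-- `half k` is 2^(k-1) for positive k and 0 for k = 0, hence in every case the largest integer that
-- `Few` permits.
≤half : ∀ k {n} → 2 * n ≤ 2 ^ k → n ≤ half k
≤half k {n} le = subst (_≤ half k) (sym (n≡⌊n+n/2⌋ n))
  (⌊n/2⌋-mono (subst (_≤ 2 ^ k) (cong (n +_) (+-identityʳ n)) le))

-- Codes inject into posets with equal weights. The matching relation includes validity, on which
-- the injectivity of `rel` rests.
mainTerm≤upsetTuples : ∀ k m → mainTerm k m ≤ sumOver (posets k) (λ Q → upsetCount Q ^ m)
mainTerm≤upsetTuples k m = subst (_≤ sumOver (posets k) (λ Q → upsetCount Q ^ m)) (sumOver-codes k m)
  (sumOver-injection (λ γ Q → Valid γ × rel γ ≈ Q) (λ γ → upsetCount (rel γ) ^ m) (λ Q → upsetCount Q ^ m) (codes k) (posets k)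
    (codes-unique k) to λ {γ} {γ′} (v , eq) (v′ , eq′) → rel-injective γ γ′ v v′ (≈-trans eq (≈-sym eq′)))
  where
  to : ∀ {γ} → γ ∈ codes k → ∃[ Q ] Q ∈ posets k × (Valid γ × rel γ ≈ Q) × upsetCount (rel γ) ^ m ≤ upsetCount Q ^ m
  to {γ} γ∈ with posets-complete (rel-poset γ (codes-valid γ∈))
  ... | Q , Q∈ , eq = Q , Q∈ , (codes-valid γ∈ , eq) , ≤-reflexive (cong (_^ m) (upsetCount-cong eq))

-- A poset is sent to a code of it, with its own weight, or to itself with weight `half k ^ m` if it
-- has few up-sets.
upsetTuples≤mainTerm+ : ∀ k m → sumOver (posets k) (λ Q → upsetCount Q ^ m) ≤ mainTerm k m + length (posets k) * half k ^ m
upsetTuples≤mainTerm+ k m = begin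
  sumOver (posets k) (λ Q → upsetCount Q ^ m)
    ≤⟨ sumOver-injection Match (λ Q → upsetCount Q ^ m) v (posets k) (map inj₁ (codes k) ++ map inj₂ (posets k))
         (posets-unique k) to (λ {Q} {Q′} {r} → inj {Q} {Q′} {r}) ⟩
  sumOver (map inj₁ (codes k) ++ map inj₂ (posets k)) v
    ≡⟨ sumOver-++ v (map inj₁ (codes k)) (map inj₂ (posets k)) ⟩
  sumOver (map inj₁ (codes k)) v + sumOver (map inj₂ (posets k)) v
    ≡⟨ cong₂ _+_ (trans (sumOver-map v inj₁ (codes k)) (sumOver-codes k m))
                 (trans (sumOver-map v inj₂ (posets k)) (sumOver-const _ (posets k))) ⟩
  mainTerm k m + length (posets k) * half k ^ m ∎
  where
  open ≤-Reasoning
  Match : Rel k → Code k ⊎ Rel k → Set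
  Match Q (inj₁ γ)  = Q ≈ rel γ
  Match Q (inj₂ Q′) = Q ≈ Q′
  v : Code k ⊎ Rel k → ℕ
  v (inj₁ γ) = upsetCount (rel γ) ^ m
  v (inj₂ _) = half k ^ m
  inj : ∀ {Q Q′ r} → Match Q r → Match Q′ r → Q ≈ Q′
  inj {r = inj₁ γ} h h′ = ≈-trans h (≈-sym h′)
  inj {r = inj₂ _} h h′ = ≈-trans h (≈-sym h′)
  to : ∀ {Q} → Q ∈ posets k → ∃[ r ] r ∈ (map inj₁ (codes k) ++ map inj₂ (posets k)) × Match Q r × upsetCount Q ^ m ≤ v r
  to {Q} Q∈ with few-or-code (posets-sound Q∈)
  ... | inj₁ f = inj₂ Q , ∈-++⁺ʳ (map inj₁ (codes k)) (∈-map⁺ inj₂ Q∈) , (λ _ _ → refl) , ^-monoˡ-≤ m (≤half k f)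
  ... | inj₂ (γ , γ∈ , eq) = inj₁ γ , ∈-++⁺ˡ (∈-map⁺ inj₁ γ∈) , eq , ≤-reflexive (cong (_^ m) (upsetCount-cong eq))

-- Error estimates

∣-∣-bound : ∀ {a b c d} → a ≤ b + c → b ≤ a + d → ∣ a - b ∣ ≤ c + d
∣-∣-bound {a} {b} {c} {d} a≤ b≤ with ≤-total a b
... | inj₁ a≤b = subst (_≤ c + d) (sym (m≤n⇒∣m-n∣≡n∸m a≤b)) (≤-trans (m≤n+o⇒m∸n≤o b a b≤) (m≤n+m d c))
... | inj₂ b≤a = subst (_≤ c + d) (sym (m≤n⇒∣n-m∣≡n∸m b≤a)) (≤-trans (m≤n+o⇒m∸n≤o a b a≤) (m≤m+n c d))

^-distribʳ-* : ∀ a b n → (a * b) ^ n ≡ a ^ n * b ^ n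
^-distribʳ-* a b zero    = refl
^-distribʳ-* a b (suc n) = trans (cong (a * b *_) (^-distribʳ-* a b n)) (shuffle a b (a ^ n) (b ^ n))
  where
  shuffle : ∀ a b c d → a * b * (c * d) ≡ a * c * (b * d)
  shuffle = solve-∀

-- The comparison h / 2^k ≤ b / a raised to the power m, without fractions. It is applied with b / a
-- equal to 1/2 and to 3/4.
^*^-mono-≤ : ∀ k m {h a b} → h * a ≤ 2 ^ k * b → h ^ m * a ^ m ≤ 2 ^ (k * m) * b ^ m
^*^-mono-≤ k m {h} {a} {b} le = begin
  h ^ m * a ^ m         ≡⟨ ^-distribʳ-* h a m ⟨
  (h * a) ^ m           ≤⟨ ^-monoˡ-≤ m le ⟩
  (2 ^ k * b) ^ m       ≡⟨ ^-distribʳ-* (2 ^ k) b m ⟩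
  (2 ^ k) ^ m * b ^ m   ≡⟨ cong (_* b ^ m) (^-*-assoc 2 k m) ⟩
  2 ^ (k * m) * b ^ m   ∎
  where open ≤-Reasoning

correctionCoefficients : ℕ → ℕ
correctionCoefficients k = ∑< (suc k ∸ 2) (λ j → z (2 + j) * (k choose (2 + j)))

-- From i ≥ 2 follows 2^(k-1) + 2^(k-i) ≤ (3/4) 2^k, with equality at i = 2; this is where 3/4 comes
-- from. For k ≤ 1 the sum is empty.
correction-bound : ∀ k m → correction k m * 4 ^ m ≤ correctionCoefficients k * (2 ^ (k * m) * 3 ^ m)
correction-bound 0 m = z≤n
correction-bound 1 m = z≤n
correction-bound (suc (suc n)) m = begin
  correction K m * 4 ^ m                                ≡⟨ cong (_* 4 ^ m) (sumFromTo≡∑< 2 K (λ i → z i * (K choose i) * starValue K i ^ m)) ⟩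
  ∑< (suc n) (λ j → coeff j * val j ^ m) * 4 ^ m        ≡⟨ ∑<-*ʳ (suc n) (λ j → coeff j * val j ^ m) (4 ^ m) ⟩
  ∑< (suc n) (λ j → coeff j * val j ^ m * 4 ^ m)        ≤⟨ ∑<-mono (suc n) term ⟩
  ∑< (suc n) (λ j → coeff j * (2 ^ (K * m) * 3 ^ m))    ≡⟨ ∑<-*ʳ (suc n) coeff _ ⟨
  correctionCoefficients K * (2 ^ (K * m) * 3 ^ m)      ∎
  where
  open ≤-Reasoning
  K : ℕ
  K = suc (suc n)
  coeff val : ℕ → ℕ
  coeff j = z (2 + j) * (K choose (2 + j))
  val j   = starValue K (2 + j)
  expand : ∀ x → (2 * x + x) * 4 ≡ 2 * (2 * x) * 3
  expand = solve-∀
  val*4≤ : ∀ j → val j * 4 ≤ 2 ^ K * 3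
  val*4≤ j = begin
    (2 ^ suc n + 2 ^ (n ∸ j)) * 4   ≤⟨ *-monoˡ-≤ 4 (+-monoʳ-≤ (2 ^ suc n) (^-monoʳ-≤ 2 (m∸n≤m n j))) ⟩
    (2 ^ suc n + 2 ^ n) * 4         ≡⟨ expand (2 ^ n) ⟩
    2 ^ K * 3                       ∎
  term : ∀ j → coeff j * val j ^ m * 4 ^ m ≤ coeff j * (2 ^ (K * m) * 3 ^ m)
  term j = begin
    coeff j * val j ^ m * 4 ^ m        ≡⟨ *-assoc (coeff j) (val j ^ m) (4 ^ m) ⟩
    coeff j * (val j ^ m * 4 ^ m)      ≤⟨ *-monoʳ-≤ (coeff j) (^*^-mono-≤ K m {val j} (val*4≤ j)) ⟩
    coeff j * (2 ^ (K * m) * 3 ^ m)    ∎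

module _ (k : ℕ) where

  private
    N : ℕ
    N = length (posets k)

  -- One `half k ^ m` per poset pays for the posets with few up-sets, and one per poset and avoided
  -- element for the tuples that do not cover.
  c₁ c₂ : ℕ
  c₁ = N + N * k
  c₂ = correctionCoefficients k

  e≤main+ : ∀ m → e k m ≤ mainTerm k m + N * half k ^ m
  e≤main+ m = ≤-trans (e≤upsetTuples k m) (upsetTuples≤mainTerm+ k m)

  main≤e+ : ∀ m → mainTerm k m ≤ e k m + N * k * half k ^ m
  main≤e+ m = begin
    mainTerm k m                                ≤⟨ mainTerm≤upsetTuples k m ⟩
    sumOver (posets k) (λ Q → upsetCount Q ^ m) ≤⟨ upsetTuples≤e+uncovered k m ⟩
    e k m + length (uncovered k m)              ≤⟨ +-monoʳ-≤ (e k m) (length-uncovered k m (λ x → ≤half k (length-subsetsAvoiding x))) ⟩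
    e k m + N * (k * half k ^ m)                ≡⟨ cong (e k m +_) (sym (*-assoc N k (half k ^ m))) ⟩
    e k m + N * k * half k ^ m                  ∎
    where open ≤-Reasoning

  half*2≤ : half k * 2 ≤ 2 ^ k
  half*2≤ = subst (_≤ 2 ^ k) (*-comm 2 (half k)) (2*half≤ k)

  -- The bound of order 2^((k-1)m), multiplied by 2^m so that k = 0 needs no separate treatment. It
  -- holds for every m, with no threshold.
  main-estimate : ∀ m → ∣ e k m - mainTerm k m ∣ * 2 ^ m ≤ c₁ * 2 ^ (k * m)
  main-estimate m = begin
    ∣ e k m - mainTerm k m ∣ * 2 ^ m                ≤⟨ *-monoˡ-≤ (2 ^ m) (∣-∣-bound (e≤main+ m) (main≤e+ m)) ⟩
    (N * half k ^ m + N * k * half k ^ m) * 2 ^ m   ≡⟨ shuffle N (N * k) (half k ^ m) (2 ^ m) ⟩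
    c₁ * (half k ^ m * 2 ^ m)                       ≤⟨ *-monoʳ-≤ c₁ (^*^-mono-≤ k m {half k} {2} {1} (subst (half k * 2 ≤_) (sym (*-identityʳ (2 ^ k))) half*2≤)) ⟩
    c₁ * (2 ^ (k * m) * 1 ^ m)                      ≡⟨ cong (c₁ *_) (trans (cong (2 ^ (k * m) *_) (^-zeroˡ m)) (*-identityʳ _)) ⟩
    c₁ * 2 ^ (k * m)                                ∎
    where
    open ≤-Reasoning
    shuffle : ∀ a b h t → (a * h + b * h) * t ≡ (a + b) * (h * t)
    shuffle = solve-∀

  half*4≤ : half k * 4 ≤ 2 ^ k * 3
  half*4≤ = begin
    half k * 4      ≡⟨ *-assoc (half k) 2 2 ⟨
    half k * 2 * 2  ≤⟨ *-mono-≤ half*2≤ (n≤1+n 2) ⟩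
    2 ^ k * 3       ∎
    where open ≤-Reasoning

  -- The correction sum has relative size (3/4)^m, and the remaining error, of relative size
  -- (1/2)^m, is weakened to the same rate.
  leading-estimate : ∀ m → ∣ e k m - 2 ^ (k * m) ∣ * 4 ^ m ≤ (c₂ + c₁) * 2 ^ (k * m) * 3 ^ m
  leading-estimate m = begin
    ∣ e k m - 2 ^ (k * m) ∣ * 4 ^ m
      ≤⟨ *-monoˡ-≤ (4 ^ m) (∣-∣-bound {c = correction k m + N * H}
           (≤-trans (e≤main+ m) (≤-reflexive (+-assoc (2 ^ (k * m)) (correction k m) _)))
           (≤-trans (m≤m+n (2 ^ (k * m)) (correction k m)) (main≤e+ m))) ⟩
    (correction k m + N * H + N * k * H) * 4 ^ m
      ≡⟨ shuffle (correction k m) N (N * k) H (4 ^ m) ⟩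
    correction k m * 4 ^ m + c₁ * (H * 4 ^ m)
      ≤⟨ +-mono-≤ (correction-bound k m) (*-monoʳ-≤ c₁ (^*^-mono-≤ k m {half k} half*4≤)) ⟩
    c₂ * (2 ^ (k * m) * 3 ^ m) + c₁ * (2 ^ (k * m) * 3 ^ m)
      ≡⟨ collect c₂ c₁ (2 ^ (k * m)) (3 ^ m) ⟩
    (c₂ + c₁) * 2 ^ (k * m) * 3 ^ m ∎
    where
    open ≤-Reasoning
    H : ℕ
    H = half k ^ m
    shuffle : ∀ r a b h t → (r + a * h + b * h) * t ≡ r * t + (a + b) * (h * t)
    shuffle = solve-∀
    collect : ∀ a b x y → a * (x * y) + b * (x * y) ≡ (a + b) * x * y
    collect = solve-∀

theorem6p5 : (k : ℕ) →
    (∃[ C ] ∃[ M ] ∀ m → M ≤ m → ∣ e k m - mainTerm k m ∣ * 2 ^ m ≤ C * 2 ^ (k * m))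
    × (∃[ C ] ∃[ M ] ∀ m → M ≤ m → ∣ e k m - 2 ^ (k * m) ∣ * 4 ^ m ≤ C * 2 ^ (k * m) * 3 ^ m)
theorem6p5 k = (c₁ k , 0 , λ m _ → main-estimate k m) , (c₂ k + c₁ k , 0 , λ m _ → leading-estimate k m)
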